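{- Let $H$ be a $(2,1)$-inseparable graph. Then there is a constant $C=C(H)$ such that for every $n\in\mathbb{N}$ there exists an $H$-percolating graph $\tilde G$ with $v(\tilde G)\le Cn$ and $\tau_H(\tilde G)\ge M_H(n)$.
   Context: For graphs $H$ and $G$, the $H$-process on $G$ is the sequence $(G_i)_{i\ge0}$ with $G_0=G$, $V(G_i)=V(G)$, and $E(G_i)=E(G_{i-1})\cup\{e\in\binom{V(G)}{2}: n_H(G_{i-1}+e)>n_H(G_{i-1})\}$, where $n_H(F)$ is the number of copies of $H$ in $F$ (i.e. an edge is added if it is the last missing edge of some copy of $H$). For finite $G$ the running time is $\tau_H(G)=\min\{t\in\mathbb{N}: G_t=G_{t+1}\}$, and the final graph is $G_{\tau_H(G)}$. $G$ is $H$-percolating if its final graph is the complete graph on $V(G)$. $M_H(n)=\max\{\tau_H(G): G \text{ an } n\text{ -vertex graph}\}$. A graph $H$ with an edge is $(2,1)$-separable if it can be disconnected by deleting at most two vertices (with incident edges) and one further edge; otherwise it is $(2,1)$-inseparable. -}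

module Defs where

open import Data.Nat using (ℕ; zero; suc; _≤_; _<_)
open import Data.Fin using (Fin)
open import Data.Fin.Subset using (Subset; _∉_; ∣_∣)
open import Data.Bool using (Bool; true)
open import Data.Maybe using (Maybe; just; nothing)
open import Data.Product using (Σ; ∃; _×_; _,_)
open import Data.Sum using (_⊎_)
open import Data.Unit using (⊤)
open import Relation.Nullary using (¬_)
open import Relation.Binary.PropositionalEquality using (_≡_; _≢_)
open import Relation.Binary.Construct.Closure.ReflexiveTransitive using (Star)

record Graph (n : ℕ) : Set where
  field
    adj    : Fin n → Fin n → Bool
    sym    : ∀ u v → adj u v ≡ adj v u
    irrefl : ∀ u → ¬ (adj u u ≡ true)

open Graph public

Rel : ℕ → Set₁
Rel m = Fin m → Fin m → Set

Injective : ∀ {h m} → (Fin h → Fin m) → Set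
Injective φ = ∀ a b → φ a ≡ φ b → a ≡ b

addEdge : ∀ {m} → Rel m → Fin m → Fin m → Rel m
addEdge E u v x y = E x y ⊎ ((x ≡ u × y ≡ v) ⊎ (x ≡ v × y ≡ u))

-- uv is the last missing edge of some copy of H in E, i.e. some copy of H
-- in E + uv uses the edge uv (equivalently n_H(E + uv) > n_H(E) when uv ∉ E).
CopyThrough : ∀ {h m} → Graph h → Rel m → Fin m → Fin m → Set
CopyThrough {h} {m} H E u v =
  Σ (Fin h → Fin m) λ φ →
    Injective φ
    × (∀ a b → adj H a b ≡ true → addEdge E u v (φ a) (φ b))
    × (Σ (Fin h) λ a → Σ (Fin h) λ b → adj H a b ≡ true × φ a ≡ u × φ b ≡ v)

step : ∀ {h m} → Graph h → Rel m → Rel m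
step H E u v = E u v ⊎ CopyThrough H E u v

process : ∀ {h m} → Graph h → Graph m → ℕ → Rel m
process H G zero u v = adj G u v ≡ true
process H G (suc i) = step H (process H G i)

-- G_t = G_{t+1}  (G_t ⊆ G_{t+1} holds by construction)
Stable : ∀ {h m} → Graph h → Graph m → ℕ → Set
Stable H G t = ∀ u v → process H G (suc t) u v → process H G t u v

RunningTime : ∀ {h m} → Graph h → Graph m → ℕ → Set
RunningTime H G t = Stable H G t × (∀ s → s < t → ¬ Stable H G s)

Complete : ∀ {m} → Rel m → Set
Complete E = ∀ u v → u ≢ v → E u v

Percolating : ∀ {h m} → Graph h → Graph m → Set
Percolating H G = ∀ t → RunningTime H G t → Complete (process H G t)

HasEdge : ∀ {h} → Graph h → Set
HasEdge {h} H = Σ (Fin h) λ a → Σ (Fin h) λ b → adj H a b ≡ true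

NotRemoved : ∀ {h} → Maybe (Fin h × Fin h) → Fin h → Fin h → Set
NotRemoved nothing a b = ⊤
NotRemoved (just (p , q)) a b = ¬ ((a ≡ p × b ≡ q) ⊎ (a ≡ q × b ≡ p))

RemEdge : ∀ {h} → Graph h → Subset h → Maybe (Fin h × Fin h) → Fin h → Fin h → Set
RemEdge H S f a b = adj H a b ≡ true × a ∉ S × b ∉ S × NotRemoved f a b

Separable21 : ∀ {h} → Graph h → Set
Separable21 {h} H =
  Σ (Subset h) λ S → Σ (Maybe (Fin h × Fin h)) λ f →
    ∣ S ∣ ≤ 2
    × (Σ (Fin h) λ x → Σ (Fin h) λ y →
         x ∉ S × y ∉ S × ¬ Star (RemEdge H S f) x y)

{-# OPTIONS --safe #-}

-- Let δ be the minimum degree of H, let G be an n-vertex graph of maximal running time M and let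
-- uv be an edge that appears in its last step.  Boundedly many disjoint copies of G are connected
-- to a clique K by a tower of further cliques ("blocks") with the following properties.
--
-- * Before uv appears nothing happens outside the copies of G.  A block meets K only in pendant
--   edges at one vertex of K, and a set of at most h vertices meets the blocks (a copy of G counting
--   as part of a block) in a forest.  A leaf block is therefore cut off by two vertices, so by
--   (2,1)-inseparability a copy of H minus an edge lies in one block, where a degree count or
--   a further 2-separation shows that it lies in a clique or in a copy of G.
-- * Once uv is present, its block acquires an edge to K, and then the tower is infected layer by
--   layer: every point of a layer lies in δ - 1 blocks of its layer and receives from each of them
--   an edge to a different vertex of K, which makes it adjacent to all of K.
--
-- The tower comes from involutions of a finite set without short relations, each layer being
-- a copy of this set; the vertices of the copies of G occupy layers that are far apart.
module Submission where

open import Defs hiding (sym)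
open import Data.Bool using (Bool; true; false; if_then_else_; _∧_; _∨_; not)
open import Data.Bool.Properties as Boolᵖ using (∨-comm)
open import Data.Empty using (⊥; ⊥-elim)
open import Data.Fin as Fin using (Fin; zero; suc; combine; remQuot; finToFun; funToFin; opposite; toℕ; fromℕ<; inject≤; inject₁)
open import Data.Fin.Properties as Finᵖ using (remQuot-combine; combine-remQuot; funToFin-finToFin; finToFun-funToFin; opposite-involutive; any?; all?; pigeonhole; combine-injective; inject≤-injective; toℕ-injective; toℕ-fromℕ<; +↔⊎; *↔×)
open import Data.Fin.Subset as Sub using (Subset; ⁅_⁆; _∪_; ∣_∣) renaming (_∉_ to _∉ₛ_; _∈_ to _∈ₛ_)
import Data.Fin.Subset.Properties as Subᵖ
open import Data.List using (List; []; _∷_; _++_; length; map; filter; allFin; lookup; tabulate; take)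
import Data.List.Membership.DecPropositional as DecMembership
open import Data.List.Membership.Propositional using (_∈_; _∉_)
open import Data.List.Membership.Propositional.Properties using (∈-∃++; ∈-++⁻; ∈-++⁺ˡ; ∈-++⁺ʳ; ∈-map⁻; ∈-filter⁺; ∈-filter⁻; ∈-allFin; ∈-lookup; ∈-tabulate⁺; ∈-tabulate⁻)
open import Data.List.Properties using (++-assoc; length-++; length-map; length-tabulate; length-take)
open import Data.List.Relation.Unary.All as All using (All; []; _∷_)
import Data.List.Relation.Unary.All.Properties as Allᵖ
open import Data.List.Relation.Unary.AllPairs using ([]; _∷_)
open import Data.List.Relation.Unary.Any using (here; there; index)
open import Data.List.Relation.Unary.Any.Properties using (lookup-index)
open import Data.List.Relation.Unary.Linked using (Linked; []; [-]; _∷_)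
open import Data.List.Relation.Unary.Unique.Propositional using (Unique)
import Data.List.Relation.Unary.Unique.Propositional.Properties as Uniqueᵖ
open import Data.Maybe using (just; nothing)
open import Data.Nat using (ℕ; zero; suc; _+_; _*_; _^_; _≤_; z≤n; s≤s; _<_; _<?_)
import Data.Nat.Properties as ℕᵖ
open import Data.Product using (Σ; _×_; _,_; proj₁; proj₂)
open import Data.Product.Function.NonDependent.Propositional using (_×-↔_)
open import Data.Sum as Sum using (_⊎_; inj₁; inj₂)
open import Data.Sum.Function.Propositional using (_⊎-↔_)
open import Data.Unit using (⊤; tt)
open import Data.Vec using ([]; _∷_)
open import Function using (_∘_; _↔_; Inverse; mk↔ₛ′)
open import Function.Construct.Composition using (_↔-∘_)
open import Function.Construct.Identity using (↔-id)
open import Function.Construct.Symmetry using (↔-sym)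
open import Relation.Binary.Construct.Closure.ReflexiveTransitive using (Star; ε; _◅_)
open import Relation.Binary.Definitions using (DecidableEquality)
open import Relation.Binary.PropositionalEquality using (_≡_; _≢_; _≗_; refl; sym; trans; cong; cong₂; subst; module ≡-Reasoning; subst₂)
open import Relation.Nullary using (¬_; Dec; yes; no; contradiction; does)
open import Relation.Nullary.Decidable using (map′; _×-dec_; _⊎-dec_; _→-dec_; ¬?; decidable-stable)
open import Relation.Unary using (Decidable)

-- Free involutions

act : ∀ {c p} → (Fin c → Fin p → Fin p) → List (Fin c) → Fin p → Fin p
act σ []      x = x
act σ (i ∷ w) x = act σ w (σ i x)

act-++ : ∀ {c p} (σ : Fin c → Fin p → Fin p) u w x → act σ (u ++ w) x ≡ act σ w (act σ u x)
act-++ σ []      w x = refl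
act-++ σ (i ∷ u) w x = act-++ σ u w (σ i x)

Reduced : ∀ {c} → List (Fin c) → Set
Reduced = Linked _≢_

Linked-tail : ∀ {A : Set} {R : A → A → Set} {x xs} → Linked R (x ∷ xs) → Linked R xs
Linked-tail [-]     = []
Linked-tail (_ ∷ l) = l

Linked-++ˡ : ∀ {A : Set} {R : A → A → Set} xs {ys} → Linked R (xs ++ ys) → Linked R xs
Linked-++ˡ []           l       = []
Linked-++ˡ (x ∷ [])     l       = [-]
Linked-++ˡ (x ∷ y ∷ xs) (r ∷ l) = r ∷ Linked-++ˡ (y ∷ xs) l

record FreeInvolutions (c k : ℕ) : Set where
  field
    size  : ℕ
    base  : Fin size
    σ     : Fin c → Fin size → Fin size
    invol : ∀ i x → σ i (σ i x) ≡ x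
    free  : ∀ i w → Reduced (i ∷ w) → length (i ∷ w) ≤ k → ∀ x → act σ (i ∷ w) x ≢ x

funToFin-cong : ∀ {m n} {f g : Fin m → Fin n} → f ≗ g → funToFin f ≡ funToFin g
funToFin-cong {zero}  f≗g = refl
funToFin-cong {suc m} f≗g = cong₂ combine (f≗g zero) (funToFin-cong (f≗g ∘ suc))

opposite₂-≢ : (x : Fin 2) → opposite x ≢ x
opposite₂-≢ zero       ()
opposite₂-≢ (suc zero) ()

-- The ℤ/2-homology cover: crossing the edge {x, σ i x} of colour i flips the bit
-- of that edge, so a shortest closed reduced walk downstairs no longer closes up.
module Cover {c k : ℕ} (Φ : FreeInvolutions c k) where
  open FreeInvolutions Φ

  bits size′ : ℕ
  bits  = 2 ^ (c * size)
  size′ = size * bits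

  pos : Fin size′ → Fin size
  pos z = proj₁ (remQuot bits z)

  bit : Fin size′ → Fin c → Fin size → Fin 2
  bit z j y = finToFun (proj₂ (remQuot {size} bits z)) (combine j y)

  make : Fin size → (Fin c → Fin size → Fin 2) → Fin size′
  make x f = combine x (funToFin (λ q → f (proj₁ (remQuot size q)) (proj₂ (remQuot {c} size q))))

  pos-make : ∀ x f → pos (make x f) ≡ x
  pos-make x f = cong proj₁ (remQuot-combine x _)

  bit-make : ∀ x f j y → bit (make x f) j y ≡ f j y
  bit-make x f j y = begin
    finToFun (proj₂ (remQuot {size} bits (make x f))) (combine j y)
      ≡⟨ cong (λ r → finToFun (proj₂ r) (combine j y)) (remQuot-combine x _) ⟩
    finToFun (funToFin {c * size} (λ q → f (proj₁ (remQuot size q)) (proj₂ (remQuot {c} size q)))) (combine j y)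
      ≡⟨ finToFun-funToFin {c * size} _ (combine j y) ⟩
    f (proj₁ (remQuot size (combine j y))) (proj₂ (remQuot {c} size (combine j y)))
      ≡⟨ cong (λ r → f (proj₁ r) (proj₂ r)) (remQuot-combine j y) ⟩
    f j y ∎
    where open ≡-Reasoning

  make-cong : ∀ {x y f g} → x ≡ y → (∀ j z → f j z ≡ g j z) → make x f ≡ make y g
  make-cong x≡y f≗g = cong₂ combine x≡y (funToFin-cong {c * size} (λ q → f≗g _ _))

  make-η : ∀ z → make (pos z) (bit z) ≡ z
  make-η z = begin
    make (pos z) (bit z)
      ≡⟨ cong (combine (pos z)) (funToFin-cong {c * size} λ q →
           cong (finToFun (proj₂ (remQuot {size} bits z))) (combine-remQuot {c} size q)) ⟩
    combine (pos z) (funToFin (finToFun {2} {c * size} (proj₂ (remQuot {size} bits z))))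
      ≡⟨ cong (combine (pos z)) (funToFin-finToFin {c * size} {2} _) ⟩
    combine (pos z) (proj₂ (remQuot {size} bits z))
      ≡⟨ combine-remQuot {size} bits z ⟩
    z ∎
    where open ≡-Reasoning

  onEdge : Fin c → Fin size → Fin c → Fin size → Bool
  onEdge i x j y = does (j Finᵖ.≟ i) ∧ (does (y Finᵖ.≟ x) ∨ does (y Finᵖ.≟ σ i x))

  onEdge-σ : ∀ i x j y → onEdge i (σ i x) j y ≡ onEdge i x j y
  onEdge-σ i x j y rewrite invol i x =
    cong (does (j Finᵖ.≟ i) ∧_) (∨-comm (does (y Finᵖ.≟ σ i x)) (does (y Finᵖ.≟ x)))

  flip : (Fin c → Fin size → Bool) → (Fin c → Fin size → Fin 2) → Fin c → Fin size → Fin 2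
  flip b f j y = if b j y then opposite (f j y) else f j y

  σ′ : Fin c → Fin size′ → Fin size′
  σ′ i z = make (σ i (pos z)) (flip (onEdge i (pos z)) (bit z))

  pos-σ′ : ∀ i z → pos (σ′ i z) ≡ σ i (pos z)
  pos-σ′ i z = pos-make _ (flip (onEdge i (pos z)) (bit z))

  bit-σ′ : ∀ i z j y → bit (σ′ i z) j y ≡ flip (onEdge i (pos z)) (bit z) j y
  bit-σ′ i z j y = bit-make (σ i (pos z)) _ j y

  invol′ : ∀ i z → σ′ i (σ′ i z) ≡ z
  invol′ i z = trans (make-cong (trans (cong (σ i) (pos-σ′ i z)) (invol i (pos z))) bits≡) (make-η z)
    where
    bits≡ : ∀ j y → flip (onEdge i (pos (σ′ i z))) (bit (σ′ i z)) j y ≡ bit z j y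
    bits≡ j y
      rewrite pos-σ′ i z | onEdge-σ i (pos z) j y | bit-σ′ i z j y with onEdge i (pos z) j y
    ... | true  = opposite-involutive (bit z j y)
    ... | false = refl

  pos-act : ∀ w z → pos (act σ′ w z) ≡ act σ w (pos z)
  pos-act []      z = refl
  pos-act (i ∷ w) z = trans (pos-act w (σ′ i z)) (cong (act σ w) (pos-σ′ i z))

  bit-hit : ∀ i z → bit (σ′ i z) i (pos z) ≡ opposite (bit z i (pos z))
  bit-hit i z rewrite bit-σ′ i z i (pos z) with i Finᵖ.≟ i
  ... | no ¬p = contradiction refl ¬p
  ... | yes _ with pos z Finᵖ.≟ pos z
  ... | no ¬p = contradiction refl ¬p
  ... | yes _ = refl

  bit-miss : ∀ i z j y → ¬ (j ≡ i × (y ≡ pos z ⊎ y ≡ σ i (pos z))) → bit (σ′ i z) j y ≡ bit z j y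
  bit-miss i z j y miss rewrite bit-σ′ i z j y with j Finᵖ.≟ i
  ... | no _ = refl
  ... | yes j≡i with y Finᵖ.≟ pos z
  ... | yes y≡x = contradiction (j≡i , inj₁ y≡x) miss
  ... | no _ with y Finᵖ.≟ σ i (pos z)
  ... | yes y≡x = contradiction (j≡i , inj₂ y≡x) miss
  ... | no _ = refl

  module _ (i : Fin c) (x : Fin size) where

    bit-rest : ∀ u w z → pos z ≡ act σ u (σ i x) → Reduced (i ∷ u ++ w) → length (u ++ w) ≤ k →
               bit (act σ′ w z) i x ≡ bit z i x
    bit-rest u [] z _ _ _ = refl
    bit-rest u (j ∷ w) z at red len = trans
      (bit-rest (u ++ j ∷ []) w (σ′ j z) at′
        (subst (λ v → Reduced (i ∷ v)) (sym (++-assoc u (j ∷ []) w)) red)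
        (subst (λ v → length v ≤ k) (sym (++-assoc u (j ∷ []) w)) len))
      (bit-miss j z i x missed)
      where
      at′ : pos (σ′ j z) ≡ act σ (u ++ j ∷ []) (σ i x)
      at′ = trans (pos-σ′ j z) (trans (cong (σ j) at) (sym (act-++ σ u (j ∷ []) (σ i x))))
      short : suc (length u) ≤ k
      short = ℕᵖ.≤-trans
        (ℕᵖ.≤-trans (s≤s (ℕᵖ.m≤m+n (length u) (length w)))
          (ℕᵖ.≤-reflexive (sym (trans (length-++ u) (ℕᵖ.+-suc (length u) (length w))))))
        len
      back : ∀ v → Reduced (i ∷ v ++ j ∷ w) → suc (length v) ≤ k → i ≡ j →
             act σ v (σ i x) ≢ σ i x
      back []      (i≢j ∷ _) _ i≡j _ = i≢j i≡j
      back (a ∷ v) r l i≡j = free a v (Linked-tail (Linked-++ˡ (i ∷ a ∷ v) r)) (ℕᵖ.≤-trans (ℕᵖ.n≤1+n _) l) (σ i x)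
      missed : ¬ (i ≡ j × (x ≡ pos z ⊎ x ≡ σ j (pos z)))
      missed (i≡j , inj₁ x≡z) =
        free i u (Linked-++ˡ (i ∷ u) red) short x (sym (trans x≡z at))
      missed (refl , inj₂ x≡σz) =
        back u red short refl (trans (sym at) (trans (sym (invol i (pos z))) (cong (σ i) (sym x≡σz))))

  free′ : ∀ i w → Reduced (i ∷ w) → length (i ∷ w) ≤ suc k → ∀ z → act σ′ (i ∷ w) z ≢ z
  free′ i w red (s≤s len) z closed = opposite₂-≢ (bit z i (pos z)) (begin
    opposite (bit z i (pos z))          ≡⟨ sym (bit-hit i z) ⟩
    bit (σ′ i z) i (pos z)              ≡⟨ sym (bit-rest i (pos z) [] w (σ′ i z) (pos-σ′ i z) red len) ⟩
    bit (act σ′ w (σ′ i z)) i (pos z)   ≡⟨ cong (λ y → bit y i (pos z)) closed ⟩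
    bit z i (pos z)                     ∎)
    where open ≡-Reasoning

  cover : FreeInvolutions c (suc k)
  cover = record
    { size = size′ ; base = make base (λ _ _ → zero) ; σ = σ′ ; invol = invol′ ; free = free′ }

freeInvolutions : ∀ c k → FreeInvolutions c k
freeInvolutions c zero = record
  { size = 1 ; base = zero ; σ = λ _ x → x ; invol = λ _ _ → refl ; free = λ _ _ _ () }
freeInvolutions c (suc k) = Cover.cover (freeInvolutions c k)

-- The process is decidable and stops

least : {P : ℕ → Set} → Decidable P → ∀ n →
        (∀ s → s < n → ¬ P s) ⊎ Σ ℕ λ t → t < n × P t × (∀ s → s < t → ¬ P s)
least P? zero = inj₁ λ _ ()
least P? (suc n) with least P? n
... | inj₂ (t , t<n , p , min) = inj₂ (t , ℕᵖ.m<n⇒m<1+n t<n , p , min)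
... | inj₁ none with P? n
... | yes p = inj₂ (n , ℕᵖ.≤-refl , p , none)
... | no ¬p = inj₁ λ { s (s≤s s≤n) ps → upTo-n (ℕᵖ.m≤n⇒m<n∨m≡n s≤n) ps }
  where
  upTo-n : ∀ {s} → s < n ⊎ s ≡ n → ¬ _
  upTo-n (inj₁ s<n)  ps = none _ s<n ps
  upTo-n (inj₂ refl) ps = ¬p ps

greatest : {P : ℕ → Set} → Decidable P → ∀ n →
           (∀ s → s ≤ n → ¬ P s) ⊎ Σ ℕ λ t → P t × (∀ s → s ≤ n → P s → s ≤ t)
greatest P? n with P? n
... | yes p = inj₂ (n , p , λ _ s≤n _ → s≤n)
greatest P? zero    | no ¬p = inj₁ λ { _ z≤n → ¬p }
greatest {P} P? (suc n) | no ¬p = Sum.map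
  (λ none s s≤ ps → none s (lower s≤ ps) ps)
  (λ (t , p , max) → t , p , λ s s≤ ps → max s (lower s≤ ps) ps)
  (greatest P? n)
  where
  lower : ∀ {s} → s ≤ suc n → P s → s ≤ n
  lower s≤ ps with ℕᵖ.m≤n⇒m<n∨m≡n s≤
  ... | inj₁ (s≤s s≤n) = s≤n
  ... | inj₂ refl      = contradiction ps ¬p

∃-fun? : ∀ {h m} {P : (Fin h → Fin m) → Set} → (∀ {f g} → f ≗ g → P f → P g) →
         (∀ f → Dec (P f)) → Dec (Σ _ P)
∃-fun? resp P? = map′
  (λ (q , p) → finToFun q , p)
  (λ (f , p) → funToFin f , resp (sym ∘ finToFun-funToFin f) p)
  (any? λ q → P? (finToFun q))

module _ {h : ℕ} (H : Graph h) where

  CopyThrough-mono : ∀ {m} (E E′ : Rel m) → (∀ {x y} → E x y → E′ x y) →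
                     ∀ {u v} → CopyThrough H E u v → CopyThrough H E′ u v
  CopyThrough-mono E E′ E⊆E′ (φ , inj , edge , last) =
    φ , inj , (λ a b ab → Sum.map₁ E⊆E′ (edge a b ab)) , last

  CopyThrough-sym : ∀ {m} (E : Rel m) {u v} → CopyThrough H E u v → CopyThrough H E v u
  CopyThrough-sym E (φ , inj , edge , a , b , ab , a↦u , b↦v) =
    φ , inj , (λ c d cd → Sum.map₂ Sum.swap (edge c d cd)) ,
    b , a , trans (Graph.sym H b a) ab , b↦v , a↦u

  CopyThrough-irrefl : ∀ {m} (E : Rel m) {u} → ¬ CopyThrough H E u u
  CopyThrough-irrefl E (φ , inj , edge , a , b , ab , a↦u , b↦u)
    with refl ← inj a b (trans a↦u (sym b↦u)) = irrefl H a ab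

  CopyThrough? : ∀ {m} (E : Rel m) → (∀ x y → Dec (E x y)) → ∀ u v → Dec (CopyThrough H E u v)
  CopyThrough? E E? u v = ∃-fun? resp λ φ →
    (all? λ a → all? λ b → (φ a Finᵖ.≟ φ b) →-dec (a Finᵖ.≟ b)) ×-dec
    (all? λ a → all? λ b → (adj H a b Boolᵖ.≟ true) →-dec
      (E? (φ a) (φ b) ⊎-dec (((φ a Finᵖ.≟ u) ×-dec (φ b Finᵖ.≟ v)) ⊎-dec ((φ a Finᵖ.≟ v) ×-dec (φ b Finᵖ.≟ u))))) ×-dec
    (any? λ a → any? λ b → (adj H a b Boolᵖ.≟ true) ×-dec ((φ a Finᵖ.≟ u) ×-dec (φ b Finᵖ.≟ v)))
    where
    resp : ∀ {f g} → f ≗ g → _ → _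
    resp {f} {g} f≗g (inj , edge , a , b , ab , a↦u , b↦v) =
      (λ x y gx≡gy → inj x y (trans (f≗g x) (trans gx≡gy (sym (f≗g y))))) ,
      (λ x y xy → subst₂ (addEdge E u v) (f≗g x) (f≗g y) (edge x y xy)) ,
      a , b , ab , trans (sym (f≗g a)) a↦u , trans (sym (f≗g b)) b↦v

  module _ {m : ℕ} (G : Graph m) where

    process? : ∀ t u v → Dec (process H G t u v)
    process? zero    u v = adj G u v Boolᵖ.≟ true
    process? (suc t) u v = process? t u v ⊎-dec CopyThrough? (process H G t) (process? t) u v

    process-sym : ∀ t {u v} → process H G t u v → process H G t v u
    process-sym zero    {u} {v} uv = trans (Graph.sym G v u) uv
    process-sym (suc t) (inj₁ uv) = inj₁ (process-sym t uv)
    process-sym (suc t) (inj₂ uv) = inj₂ (CopyThrough-sym (process H G t) uv)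

    process-irrefl : ∀ t {u} → ¬ process H G t u u
    process-irrefl zero    uu        = irrefl G _ uu
    process-irrefl (suc t) (inj₁ uu) = process-irrefl t uu
    process-irrefl (suc t) (inj₂ uu) = CopyThrough-irrefl (process H G t) uu

    process-≤ : ∀ {s t} → s ≤ t → ∀ {u v} → process H G s u v → process H G t u v
    process-≤ {t = zero}  z≤n uv = uv
    process-≤ {t = suc t} s≤t uv with ℕᵖ.m≤n⇒m<n∨m≡n s≤t
    ... | inj₁ (s≤s s≤t′) = inj₁ (process-≤ s≤t′ uv)
    ... | inj₂ refl       = uv

    Stable? : ∀ t → Dec (Stable H G t)
    Stable? t = all? λ u → all? λ v → process? (suc t) u v →-dec process? t u v

    newEdge : ∀ t → ¬ Stable H G t →
              Σ (Fin m) λ u → Σ (Fin m) λ v → process H G (suc t) u v × ¬ process H G t u v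
    newEdge t ¬stable with any? (λ u → any? λ v → process? (suc t) u v ×-dec ¬? (process? t u v))
    ... | yes new = new
    ... | no none = contradiction
      (λ u v uv → decidable-stable (process? t u v) λ ¬uv → none (u , v , uv , ¬uv)) ¬stable

    -- An edge is new at most once, so one of the first m² + 1 steps adds nothing.
    stabilises : Σ ℕ λ t → t ≤ m * m × Stable H G t
    stabilises with any? (λ (i : Fin (suc (m * m))) → Stable? (toℕ i))
    ... | yes (i , st) = toℕ i , ℕᵖ.≤-pred (Finᵖ.toℕ<n i) , st
    ... | no none = ⊥-elim (clash (pigeonhole ℕᵖ.≤-refl pair))
      where
      New : ℕ → Fin m → Fin m → Set
      New t u v = process H G (suc t) u v × ¬ process H G t u v
      new : (i : Fin (suc (m * m))) → Σ (Fin m) λ u → Σ (Fin m) λ v → New (toℕ i) u v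
      new i = newEdge (toℕ i) λ st → none (i , st)
      pair : Fin (suc (m * m)) → Fin (m * m)
      pair i = combine (proj₁ (new i)) (proj₁ (proj₂ (new i)))
      once : ∀ {s t u v u′ v′} → s < t → New s u v → New t u′ v′ → u ≡ u′ → v ≡ v′ → ⊥
      once s<t (uv , _) (_ , ¬uv) refl refl = ¬uv (process-≤ s<t uv)
      clash : ¬ (Σ (Fin (suc (m * m))) λ i → Σ (Fin (suc (m * m))) λ j → i Fin.< j × pair i ≡ pair j)
      clash (i , j , i<j , eq) =
        once i<j (proj₂ (proj₂ (new i))) (proj₂ (proj₂ (new j)))
          (proj₁ split) (proj₂ split)
        where split = combine-injective {m} {m} _ _ _ _ eq

    runningTime : Σ ℕ (RunningTime H G)
    runningTime = first (proj₁ stabilises) (proj₂ (proj₂ stabilises))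
      where
      first : ∀ t → Stable H G t → Σ ℕ (RunningTime H G)
      first t st with least Stable? (suc t)
      ... | inj₁ none              = contradiction st (none t ℕᵖ.≤-refl)
      ... | inj₂ (r , _ , st , min) = r , st , min

    runningTime-≤ : ∀ {s} → RunningTime H G s → s ≤ m * m
    runningTime-≤ (_ , min) = let t , t≤ , st = stabilises in
      ℕᵖ.≤-trans (ℕᵖ.≮⇒≥ λ t<s → min t t<s st) t≤

    RunningTime? : ∀ s → Dec (RunningTime H G s)
    RunningTime? s = Stable? s ×-dec map′
      (λ f r r<s → subst (¬_ ∘ Stable H G) (Finᵖ.toℕ-fromℕ< r<s) (f (fromℕ< r<s)))
      (λ f i → f (toℕ i) (Finᵖ.toℕ<n i))
      (all? λ (i : Fin s) → ¬? (Stable? (toℕ i)))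

  process-mono : ∀ {m} {G G′ : Graph m} → (∀ u v → adj G u v ≡ true → adj G′ u v ≡ true) →
                 ∀ t {u v} → process H G t u v → process H G′ t u v
  process-mono G⊆G′ zero    uv        = G⊆G′ _ _ uv
  process-mono G⊆G′ (suc t) (inj₁ uv) = inj₁ (process-mono G⊆G′ t uv)
  process-mono {G = G} {G′} G⊆G′ (suc t) (inj₂ uv) =
    inj₂ (CopyThrough-mono (process H G t) (process H G′ t) (process-mono G⊆G′ t) uv)

  RunningTime-cong : ∀ {m} {G G′ : Graph m} → (∀ u v → adj G u v ≡ adj G′ u v) →
                     ∀ {s} → RunningTime H G s → RunningTime H G′ s
  RunningTime-cong {G = G} {G′} eq {s} (st , min) = stable⇒ s st , λ r r<s st′ → min r r<s (stable⇐ r st′)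
    where
    ⇒ : ∀ t {u v} → process H G t u v → process H G′ t u v
    ⇒ = process-mono λ u v → trans (sym (eq u v))
    ⇐ : ∀ t {u v} → process H G′ t u v → process H G t u v
    ⇐ = process-mono λ u v → trans (eq u v)
    stable⇒ : ∀ t → Stable H G t → Stable H G′ t
    stable⇒ t st u v uv = ⇒ t (st u v (⇐ (suc t) uv))
    stable⇐ : ∀ t → Stable H G′ t → Stable H G t
    stable⇐ t st u v uv = ⇐ t (st u v (⇒ (suc t) uv))

toBit : Bool → Fin 2
toBit false = zero
toBit true  = suc zero

fromBit : Fin 2 → Bool
fromBit zero    = false
fromBit (suc _) = true

fromBit-toBit : ∀ b → fromBit (toBit b) ≡ b
fromBit-toBit false = refl
fromBit-toBit true  = refl

decode : ∀ {n} → Fin (2 ^ (n * n)) → Fin n → Fin n → Bool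
decode q u v = fromBit (finToFun q (combine u v))

bits : ∀ {n} → (Fin n → Fin n → Bool) → Fin (n * n) → Fin 2
bits {n} f q = toBit (f (proj₁ (remQuot {n} n q)) (proj₂ (remQuot {n} n q)))

code : ∀ {n} → (Fin n → Fin n → Bool) → Fin (2 ^ (n * n))
code f = funToFin (bits f)

decode-code : ∀ {n} (f : Fin n → Fin n → Bool) u v → decode (code f) u v ≡ f u v
decode-code f u v = trans
  (cong fromBit (trans (finToFun-funToFin (bits f) (combine u v))
    (cong (λ r → toBit (f (proj₁ r) (proj₂ r))) (remQuot-combine u v))))
  (fromBit-toBit (f u v))

fromCode : ∀ {n} → Fin (2 ^ (n * n)) → Graph n
fromCode q = record
  { adj    = λ u v → not (does (u Finᵖ.≟ v)) ∧ (decode q u v ∨ decode q v u)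
  ; sym    = λ u v → cong₂ _∧_ (cong not (does-sym u v)) (Boolᵖ.∨-comm (decode q u v) (decode q v u))
  ; irrefl = λ u → loop u
  }
  where
  does-sym : ∀ u v → does (u Finᵖ.≟ v) ≡ does (v Finᵖ.≟ u)
  does-sym u v with u Finᵖ.≟ v | v Finᵖ.≟ u
  ... | yes _   | yes _   = refl
  ... | no _    | no _    = refl
  ... | yes u≡v | no v≢u  = contradiction (sym u≡v) v≢u
  ... | no u≢v  | yes v≡u = contradiction (sym v≡u) u≢v
  loop : ∀ u → ¬ (not (does (u Finᵖ.≟ u)) ∧ (decode q u u ∨ decode q u u) ≡ true)
  loop u p with u Finᵖ.≟ u
  loop u () | yes _
  loop u p  | no u≢u = u≢u refl

fromCode-code : ∀ {n} (G : Graph n) u v → adj (fromCode (code (adj G))) u v ≡ adj G u v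
fromCode-code G u v
  rewrite decode-code (adj G) u v | decode-code (adj G) v u | Graph.sym G v u
        | Boolᵖ.∨-idem (adj G u v) with u Finᵖ.≟ v
... | no _     = refl
... | yes refl = sym (Boolᵖ.¬-not (irrefl G u))

maxRunningTime : ∀ {h} (H : Graph h) n →
  (∀ (G : Graph n) s → ¬ RunningTime H G s) ⊎
  Σ ℕ λ M → Σ (Graph n) λ G → RunningTime H G M × (∀ (G′ : Graph n) s → RunningTime H G′ s → s ≤ M)
maxRunningTime H n = Sum.map
  (λ none G s rt → none s (runningTime-≤ H G rt) (attained G rt))
  (λ (M , (q , rt) , max) → M , fromCode q , rt , λ G s rt′ → max s (runningTime-≤ H G rt′) (attained G rt′))
  (greatest (λ s → any? λ q → RunningTime? H (fromCode {n} q) s) (n * n))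
  where
  attained : ∀ G {s} → RunningTime H G s → Σ _ λ q → RunningTime H (fromCode {n} q) s
  attained G rt = code (adj G) , RunningTime-cong H (λ u v → sym (fromCode-code G u v)) rt

-- Degrees and separations

Unique-⊆⇒length≤ : ∀ {A : Set} {xs L : List A} → Unique xs → (∀ {x} → x ∈ xs → x ∈ L) → length xs ≤ length L
Unique-⊆⇒length≤ {xs = []}     _ _ = z≤n
Unique-⊆⇒length≤ {xs = x ∷ xs} (x∉ ∷ uniq) xs⊆L with ∈-∃++ (xs⊆L (here refl))
... | ys , zs , refl = ℕᵖ.≤-trans (s≤s (Unique-⊆⇒length≤ uniq rest)) (ℕᵖ.≤-reflexive len)
  where
  rest : ∀ {w} → w ∈ xs → w ∈ ys ++ zs
  rest w∈ with ∈-++⁻ ys (xs⊆L (there w∈))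
  ... | inj₁ w∈ys          = ∈-++⁺ˡ w∈ys
  ... | inj₂ (here refl)   = contradiction refl (All.lookup x∉ w∈)
  ... | inj₂ (there w∈zs)  = ∈-++⁺ʳ ys w∈zs
  len : suc (length (ys ++ zs)) ≡ length (ys ++ x ∷ zs)
  len = trans (cong suc (length-++ ys)) (trans (sym (ℕᵖ.+-suc (length ys) (length zs))) (sym (length-++ ys)))

argmin : ∀ {n} (f : Fin n → ℕ) → Fin n → Σ (Fin n) λ a → ∀ b → f a ≤ f b
argmin {suc zero}    f _ = zero , λ { zero → ℕᵖ.≤-refl }
argmin {suc (suc n)} f _ with argmin (f ∘ suc) zero
... | a , min with ℕᵖ.≤-total (f zero) (f (suc a))
... | inj₁ 0≤a = zero  , λ { zero → ℕᵖ.≤-refl ; (suc b) → ℕᵖ.≤-trans 0≤a (min b) }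
... | inj₂ a≤0 = suc a , λ { zero → a≤0 ; (suc b) → min b }

∣p∪q∣≤∣p∣+∣q∣ : ∀ {n} (p q : Subset n) → ∣ p ∪ q ∣ ≤ ∣ p ∣ + ∣ q ∣
∣p∪q∣≤∣p∣+∣q∣ []           []           = z≤n
∣p∪q∣≤∣p∣+∣q∣ (true  ∷ p) (true  ∷ q) = s≤s (ℕᵖ.≤-trans (∣p∪q∣≤∣p∣+∣q∣ p q) (ℕᵖ.+-monoʳ-≤ ∣ p ∣ (ℕᵖ.n≤1+n ∣ q ∣)))
∣p∪q∣≤∣p∣+∣q∣ (true  ∷ p) (false ∷ q) = s≤s (∣p∪q∣≤∣p∣+∣q∣ p q)
∣p∪q∣≤∣p∣+∣q∣ (false ∷ p) (true  ∷ q) = ℕᵖ.≤-trans (s≤s (∣p∪q∣≤∣p∣+∣q∣ p q)) (ℕᵖ.≤-reflexive (sym (ℕᵖ.+-suc ∣ p ∣ ∣ q ∣)))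
∣p∪q∣≤∣p∣+∣q∣ (false ∷ p) (false ∷ q) = ∣p∪q∣≤∣p∣+∣q∣ p q

module _ {h : ℕ} (H : Graph h) where

  nbrs : Fin h → List (Fin h)
  nbrs a = filter (λ b → adj H a b Boolᵖ.≟ true) (allFin h)

  deg : Fin h → ℕ
  deg a = length (nbrs a)

  nbrs-unique : ∀ a → Unique (nbrs a)
  nbrs-unique a = Uniqueᵖ.filter⁺ _ (Uniqueᵖ.allFin⁺ h)

  ∈-nbrs⁺ : ∀ {a b} → adj H a b ≡ true → b ∈ nbrs a
  ∈-nbrs⁺ {a} {b} = ∈-filter⁺ (λ b → adj H a b Boolᵖ.≟ true) (∈-allFin b)

  ∈-nbrs⁻ : ∀ {a b} → b ∈ nbrs a → adj H a b ≡ true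
  ∈-nbrs⁻ {a} b∈ = proj₂ (∈-filter⁻ (λ b → adj H a b Boolᵖ.≟ true) {xs = allFin h} b∈)

  deg≤length : ∀ {V : Set} {φ : Fin h → V} {a} {L : List V} → (∀ {b c} → φ b ≡ φ c → b ≡ c) →
               (∀ c → adj H a c ≡ true → φ c ∈ L) → deg a ≤ length L
  deg≤length {φ = φ} {a} φ-inj into = ℕᵖ.≤-trans
    (ℕᵖ.≤-reflexive (sym (length-map φ (nbrs a))))
    (Unique-⊆⇒length≤ (Uniqueᵖ.map⁺ φ-inj (nbrs-unique a))
      (λ x∈ → let c , c∈ , x≡ = ∈-map⁻ φ x∈ in subst (_∈ _) (sym x≡) (into c (∈-nbrs⁻ c∈))))

  spread : ¬ Separable21 H → ∀ S f → ∣ S ∣ ≤ 2 → {P : Fin h → Set} → Decidable P →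
           (∀ {c d} → P c → RemEdge H S f c d → P d) → ∀ {x y} → x ∉ₛ S → y ∉ₛ S → P x → P y
  spread insep S f ∣S∣≤2 {P} P? closed {x} {y} x∉S y∉S px = decidable-stable (P? y) λ ¬py →
    insep (S , f , ∣S∣≤2 , x , y , x∉S , y∉S , λ path → ¬py (along path px))
    where
    along : ∀ {c d} → Star (RemEdge H S f) c d → P c → P d
    along ε        p = p
    along (e ◅ es) p = along es (closed p e)

  module _ {V : Set} (_≟_ : DecidableEquality V) {φ : Fin h → V} (φ-inj : ∀ {b c} → φ b ≡ φ c → b ≡ c) where

    fibre : ∀ z → Σ (Subset h) λ S → ∣ S ∣ ≤ 1 × (∀ c → φ c ≡ z → c ∈ₛ S) × (∀ c → c ∈ₛ S → φ c ≡ z)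
    fibre z with any? (λ c → φ c ≟ z)
    ... | yes (c , φc≡z) = ⁅ c ⁆ , ℕᵖ.≤-reflexive (Subᵖ.∣⁅x⁆∣≡1 c) ,
          (λ d φd≡z → subst (_∈ₛ ⁅ c ⁆) (φ-inj (trans φc≡z (sym φd≡z))) (Subᵖ.x∈⁅x⁆ c)) ,
          λ d d∈ → trans (cong φ (Subᵖ.x∈⁅y⁆⇒x≡y c d∈)) φc≡z
    ... | no none = Sub.⊥ , ℕᵖ.≤-trans (ℕᵖ.≤-reflexive (Subᵖ.∣⊥∣≡0 h)) z≤n ,
          (λ d φd≡z → contradiction (d , φd≡z) none) , λ d d∈ → contradiction d∈ Subᵖ.∉⊥

    spread-off₂ : ¬ Separable21 H → ∀ {a₀ b₀} z₁ z₂ {P : Fin h → Set} → Decidable P →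
      (∀ {c d} → P c → adj H c d ≡ true → NotRemoved (just (a₀ , b₀)) c d →
         φ c ≢ z₁ → φ d ≢ z₁ → φ d ≢ z₂ → P d) →
      ∀ {x} → φ x ≢ z₁ → φ x ≢ z₂ → P x → ∀ {y} → φ y ≢ z₁ → φ y ≢ z₂ → P y
    spread-off₂ insep {a₀} {b₀} z₁ z₂ {P} P? closed x≢z₁ x≢z₂ px y≢z₁ y≢z₂ =
      spread insep S (just (a₀ , b₀)) ∣S∣≤2 P?
        (λ { pc (cd , c∉ , d∉ , keep) → closed pc cd keep
               (λ eq → c∉ (Subᵖ.p⊆p∪q S₂ (proj₁ (proj₂ (proj₂ F₁)) _ eq)))
               (λ eq → d∉ (Subᵖ.p⊆p∪q S₂ (proj₁ (proj₂ (proj₂ F₁)) _ eq)))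
               (λ eq → d∉ (Subᵖ.q⊆p∪q S₁ S₂ (proj₁ (proj₂ (proj₂ F₂)) _ eq))) })
        (off x≢z₁ x≢z₂) (off y≢z₁ y≢z₂) px
      where
      F₁ = fibre z₁
      F₂ = fibre z₂
      S₁ = proj₁ F₁
      S₂ = proj₁ F₂
      S  = S₁ ∪ S₂
      ∣S∣≤2 : ∣ S ∣ ≤ 2
      ∣S∣≤2 = ℕᵖ.≤-trans (∣p∪q∣≤∣p∣+∣q∣ S₁ S₂) (ℕᵖ.+-mono-≤ (proj₁ (proj₂ F₁)) (proj₁ (proj₂ F₂)))
      off : ∀ {c} → φ c ≢ z₁ → φ c ≢ z₂ → c ∉ₛ S
      off c≢z₁ c≢z₂ c∈ with Subᵖ.x∈p∪q⁻ S₁ S₂ c∈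
      ... | inj₁ c∈₁ = c≢z₁ (proj₂ (proj₂ (proj₂ F₁)) _ c∈₁)
      ... | inj₂ c∈₂ = c≢z₂ (proj₂ (proj₂ (proj₂ F₂)) _ c∈₂)

  2≤deg : HasEdge H → ¬ Separable21 H → ∀ a → 2 ≤ deg a
  2≤deg (p , q , pq) insep a with nbrs a in eq
  ... | _ ∷ _ ∷ _ = s≤s (s≤s z≤n)
  ... | [] = ⊥-elim (isolated (subst (_ ∈_) eq ∘ ∈-nbrs⁺) pq′)
    where
    p≡a : p ≡ a
    p≡a = spread insep Sub.⊥ nothing (ℕᵖ.≤-trans (ℕᵖ.≤-reflexive (Subᵖ.∣⊥∣≡0 h)) z≤n) (Finᵖ._≟ a)
      (λ { refl (ad , _) → contradiction (subst (_ ∈_) eq (∈-nbrs⁺ ad)) λ () }) Subᵖ.∉⊥ Subᵖ.∉⊥ refl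
    pq′ : adj H a q ≡ true
    pq′ = subst (λ r → adj H r q ≡ true) p≡a pq
    isolated : (∀ {b} → adj H a b ≡ true → b ∈ []) → ¬ (adj H a q ≡ true)
    isolated none aq with () ← none aq
  ... | b ∷ [] = contradiction ab (subst (λ r → ¬ (adj H a r ≡ true)) (sym b≡a) (irrefl H a))
    where
    ab : adj H a b ≡ true
    ab = ∈-nbrs⁻ (subst (b ∈_) (sym eq) (here refl))
    only : ∀ {d} → adj H a d ≡ true → d ≡ b
    only ad with subst (_ ∈_) eq (∈-nbrs⁺ ad)
    ... | here d≡b = d≡b
    b≡a : b ≡ a
    b≡a = spread insep Sub.⊥ (just (a , b)) (ℕᵖ.≤-trans (ℕᵖ.≤-reflexive (Subᵖ.∣⊥∣≡0 h)) z≤n) (Finᵖ._≟ a)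
      (λ { refl (ad , _ , _ , keep) → contradiction (inj₁ (refl , only ad)) keep }) Subᵖ.∉⊥ Subᵖ.∉⊥ refl

  minDegree : HasEdge H → ¬ Separable21 H →
              Σ ℕ λ e → (Σ (Fin h) λ a → deg a ≡ 2 + e) × (∀ a → 2 + e ≤ deg a)
  minDegree edge insep with argmin deg (proj₁ edge)
  ... | a , min with deg a in eq | 2≤deg edge insep a
  ... | suc (suc e) | s≤s (s≤s _) = e , (a , eq) , min

-- Absorbing a vertex into a clique

lookup-injective : ∀ {A : Set} {xs : List A} → Unique xs → ∀ i j → lookup xs i ≡ lookup xs j → i ≡ j
lookup-injective (x∉ ∷ u) zero    zero    eq = refl
lookup-injective {xs = _ ∷ xs} (x∉ ∷ u) zero    (suc j) eq = contradiction eq (All.lookup x∉ (∈-lookup {xs = xs} j))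
lookup-injective {xs = _ ∷ xs} (x∉ ∷ u) (suc i) zero    eq = contradiction (sym eq) (All.lookup x∉ (∈-lookup {xs = xs} i))
lookup-injective (x∉ ∷ u) (suc i) (suc j) eq = cong suc (lookup-injective u i j eq)

module _ {h : ℕ} (H : Graph h) {V : Set} where

  Closed : (V → V → Set) → Set
  Closed F = ∀ (φ : Fin h → V) → (∀ {b c} → φ b ≡ φ c → b ≡ c) → ∀ {a b} → adj H a b ≡ true →
    (∀ {c d} → adj H c d ≡ true → NotRemoved (just (a , b)) c d → F (φ c) (φ d)) → F (φ a) (φ b)

  Clique : (V → V → Set) → (V → Set) → Set
  Clique F Q = ∀ {x y} → Q x → Q y → x ≢ y → F x y

  module _ (_≟_ : DecidableEquality V) {F : V → V → Set} (closed : Closed F)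
           (F-sym : ∀ {x y} → F x y → F y x) {e : ℕ} {root : Fin h} (deg-root : deg H root ≡ 2 + e) where

    open DecMembership _≟_ using (_∈?_)

    absorb : ∀ {Q : V → Set} → Clique F Q → ∀ {z} (g : List V) → Unique g → suc e ≤ length g →
             (∀ {q} → q ∈ g → Q q × q ≢ z × F z q) →
             (xs : List V) → Unique xs → (∀ {q} → q ∈ xs → Q q) →
             h + (2 + length g) ≤ length xs →
             ∀ {y} → Q y → y ≢ z → F z y
    absorb {Q} cliq {z} g g! e<∣g∣ g-ok xs xs! xs-ok big {y} qy y≢z with y ∈? g
    ... | yes y∈g = proj₂ (proj₂ (g-ok y∈g))
    ... | no y∉g = subst₂ F (val-root (role root)) (val-first first-idx (role first))
                     (closed φ (λ {b} {c} → inj (role b) (role c)) root-first λ {c} {d} → edge (role c) (role d))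
      where
      L bad ys : List V
      L   = y ∷ g
      bad = z ∷ L
      ys  = filter (λ x → ¬? (x ∈? bad)) xs
      L! : Unique L
      L! = All.tabulate (λ x∈g y≡x → y∉g (subst (_∈ g) (sym y≡x) x∈g)) ∷ g!
      h≤∣ys∣ : h ≤ length ys
      h≤∣ys∣ = ℕᵖ.+-cancelʳ-≤ (length bad) h (length ys)
        (ℕᵖ.≤-trans big (ℕᵖ.≤-trans (Unique-⊆⇒length≤ xs! split)
          (ℕᵖ.≤-reflexive (trans (length-++ bad) (ℕᵖ.+-comm (length bad) (length ys))))))
        where
        split : ∀ {x} → x ∈ xs → x ∈ bad ++ ys
        split {x} x∈ with x ∈? bad
        ... | yes x∈bad = ∈-++⁺ˡ x∈bad
        ... | no x∉bad  = ∈-++⁺ʳ bad (∈-filter⁺ (λ x → ¬? (x ∈? bad)) x∈ x∉bad)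
      ys-ok : ∀ {x} → x ∈ ys → x ∈ xs × x ∉ bad
      ys-ok = ∈-filter⁻ (λ x → ¬? (x ∈? bad)) {xs = xs}
      ns = nbrs H root
      ∣ns∣≤∣L∣ : length ns ≤ length L
      ∣ns∣≤∣L∣ = ℕᵖ.≤-trans (ℕᵖ.≤-reflexive deg-root) (s≤s e<∣g∣)
      L-ok : ∀ {x} → x ∈ L → Q x × x ≢ z
      L-ok (here refl) = qy , y≢z
      L-ok (there x∈g) = proj₁ (g-ok x∈g) , proj₁ (proj₂ (g-ok x∈g))

      data Role (b : Fin h) : Set where
        isRoot : b ≡ root → Role b
        isNbr  : b ≢ root → b ∈ ns → Role b
        other  : b ≢ root → b ∉ ns → Role b

      role : ∀ b → Role b
      role b with b Finᵖ.≟ root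
      ... | yes b≡ = isRoot b≡
      ... | no b≢ with adj H root b Boolᵖ.≟ true
      ... | yes rb = isNbr b≢ (∈-nbrs⁺ H rb)
      ... | no ¬rb = other b≢ λ b∈ → ¬rb (∈-nbrs⁻ H b∈)

      val : ∀ {b} → Role b → V
      val     (isRoot _)   = z
      val     (isNbr _ b∈) = lookup L (inject≤ (index b∈) ∣ns∣≤∣L∣)
      val {b} (other _ _)  = lookup ys (inject≤ b h≤∣ys∣)

      φ : Fin h → V
      φ b = val (role b)

      val-Q : ∀ {b} (r : Role b) → b ≢ root → Q (val r)
      val-Q (isRoot b≡)  b≢ = contradiction b≡ b≢
      val-Q (isNbr _ b∈) _  = proj₁ (L-ok (∈-lookup {xs = L} (inject≤ (index b∈) ∣ns∣≤∣L∣)))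
      val-Q (other _ _)  _  = xs-ok (proj₁ (ys-ok (∈-lookup {xs = ys} _)))

      z≢L : ∀ i → z ≢ lookup L i
      z≢L i z≡ = proj₂ (L-ok (∈-lookup {xs = L} i)) (sym z≡)
      z≢ys : ∀ i → z ≢ lookup ys i
      z≢ys i z≡ = proj₂ (ys-ok (∈-lookup {xs = ys} i)) (here (sym z≡))
      L≢ys : ∀ i j → lookup L i ≢ lookup ys j
      L≢ys i j eq = proj₂ (ys-ok (∈-lookup {xs = ys} j)) (there (subst (_∈ L) eq (∈-lookup {xs = L} i)))

      inj : ∀ {b c} (r : Role b) (s : Role c) → val r ≡ val s → b ≡ c
      inj (isRoot b≡)  (isRoot c≡)  eq = trans b≡ (sym c≡)
      inj (isRoot _)   (isNbr _ c∈) eq = contradiction eq (z≢L (inject≤ (index c∈) ∣ns∣≤∣L∣))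
      inj (isRoot _)   (other _ _)  eq = contradiction eq (z≢ys _)
      inj (isNbr _ b∈) (isRoot _)   eq = contradiction (sym eq) (z≢L (inject≤ (index b∈) ∣ns∣≤∣L∣))
      inj (isNbr _ b∈) (isNbr _ c∈) eq = trans (lookup-index b∈) (trans
        (cong (lookup ns) (inject≤-injective _ _ _ _ (lookup-injective L! _ _ eq))) (sym (lookup-index c∈)))
      inj (isNbr _ b∈) (other _ _)  eq = contradiction eq (L≢ys (inject≤ (index b∈) ∣ns∣≤∣L∣) _)
      inj (other _ _)  (isRoot _)   eq = contradiction (sym eq) (z≢ys _)
      inj (other _ _)  (isNbr _ c∈) eq = contradiction (sym eq) (L≢ys (inject≤ (index c∈) ∣ns∣≤∣L∣) _)
      inj (other _ _)  (other _ _)  eq = inject≤-injective _ _ _ _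
        (lookup-injective (Uniqueᵖ.filter⁺ (λ x → ¬? (x ∈? bad)) xs!) _ _ eq)

      hasFirst : Σ (Fin h) λ b → Σ (b ∈ ns) λ b∈ → inject≤ (index b∈) ∣ns∣≤∣L∣ ≡ zero
      hasFirst = aux ns deg-root ∣ns∣≤∣L∣
        where
        aux : ∀ (ms : List (Fin h)) {k} → length ms ≡ suc k → (le : length ms ≤ length L) →
              Σ (Fin h) λ b → Σ (b ∈ ms) λ b∈ → inject≤ (index b∈) le ≡ zero
        aux (b ∷ _) _ (s≤s _) = b , here refl , refl

      first = proj₁ hasFirst
      first-idx : ∀ (b∈ : first ∈ ns) → inject≤ (index b∈) ∣ns∣≤∣L∣ ≡ zero
      first-idx b∈ = trans
        (cong (λ i → inject≤ i ∣ns∣≤∣L∣) (lookup-injective (nbrs-unique H root) _ _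
          (trans (sym (lookup-index b∈)) (lookup-index (proj₁ (proj₂ hasFirst))))))
        (proj₂ (proj₂ hasFirst))
      root-first : adj H root first ≡ true
      root-first = ∈-nbrs⁻ H (proj₁ (proj₂ hasFirst))

      val-root : (r : Role root) → val r ≡ z
      val-root (isRoot _)  = refl
      val-root (isNbr r≢ _) = contradiction refl r≢
      val-root (other r≢ _) = contradiction refl r≢

      val-first : (∀ (b∈ : first ∈ ns) → inject≤ (index b∈) ∣ns∣≤∣L∣ ≡ zero) → (r : Role first) → val r ≡ y
      val-first idx (isRoot b≡)  = contradiction root-first
        (subst (λ r → ¬ (adj H root r ≡ true)) (sym b≡) (irrefl H root))
      val-first idx (isNbr _ b∈) = cong (lookup L) (idx b∈)
      val-first idx (other _ b∉) = contradiction (∈-nbrs⁺ H root-first) b∉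

      toNbr : ∀ {d} (r : Role d) → adj H root d ≡ true → d ≢ first → F z (val r)
      toNbr (isRoot refl) rd _  = contradiction rd (irrefl H root)
      toNbr (other _ d∉)  rd _  = contradiction (∈-nbrs⁺ H rd) d∉
      toNbr (isNbr d≢ d∈) rd d≢first with inject≤ (index d∈) ∣ns∣≤∣L∣ in eq
      ... | suc i = proj₂ (proj₂ (g-ok (∈-lookup {xs = g} i)))
      ... | zero  = contradiction
        (trans (lookup-index d∈) (trans
          (cong (lookup ns) (inject≤-injective _ _ _ _ (trans eq (sym (proj₂ (proj₂ hasFirst))))))
          (sym (lookup-index (proj₁ (proj₂ hasFirst)))))) d≢first

      inside : ∀ {c d} (r : Role c) (s : Role d) → c ≢ root → d ≢ root → adj H c d ≡ true → F (val r) (val s)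
      inside r s c≢ d≢ cd = cliq (val-Q r c≢) (val-Q s d≢) λ eq →
        irrefl H _ (subst (λ x → adj H x _ ≡ true) (inj r s eq) cd)

      edge : ∀ {c d} (r : Role c) (s : Role d) → adj H c d ≡ true → NotRemoved (just (root , first)) c d →
             F (val r) (val s)
      edge (isRoot refl) s cd keep = toNbr s cd λ d≡ → keep (inj₁ (refl , d≡))
      edge r@(isNbr _ _) (isRoot refl) cd keep =
        F-sym (toNbr r (trans (Graph.sym H _ _) cd) λ c≡ → keep (inj₂ (c≡ , refl)))
      edge r@(other _ _) (isRoot refl) cd keep =
        F-sym (toNbr r (trans (Graph.sym H _ _) cd) λ c≡ → keep (inj₂ (c≡ , refl)))
      edge r@(isNbr c≢ _) s@(isNbr d≢ _) cd keep = inside r s c≢ d≢ cd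
      edge r@(isNbr c≢ _) s@(other d≢ _) cd keep = inside r s c≢ d≢ cd
      edge r@(other c≢ _) s@(isNbr d≢ _) cd keep = inside r s c≢ d≢ cd
      edge r@(other c≢ _) s@(other d≢ _) cd keep = inside r s c≢ d≢ cd

-- The construction

*-cancelˡ-near : ∀ {L a b D} → L * a ≤ L * b + D → D < L → a ≤ b
*-cancelˡ-near {L} {a} {b} {D} le D<L = ℕᵖ.≮⇒≥ λ b<a → ℕᵖ.<⇒≱ D<L (ℕᵖ.+-cancelˡ-≤ (L * b) L D
  (ℕᵖ.≤-trans (ℕᵖ.≤-reflexive (trans (ℕᵖ.+-comm (L * b) L) (sym (ℕᵖ.*-suc L b))))
    (ℕᵖ.≤-trans (ℕᵖ.*-monoʳ-≤ L b<a) le)))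

module Construction (h e n : ℕ) (Φ : FreeInvolutions (2 + e) (2 + (h + h))) (u v : Fin n) (u≢v : u ≢ v) where

  open FreeInvolutions Φ renaming (size to p) public

  gap layers fill : ℕ
  gap    = 3 + (h + h)
  layers = suc (gap * (p * n))
  fill   = h + (3 + e)

  e≤fill : e ≤ fill
  e≤fill = ℕᵖ.≤-trans (ℕᵖ.m≤n+m e 3) (ℕᵖ.m≤n+m (3 + e) h)

  -- kk: the clique K; pt x t: the points of layer t; yy β s: private vertices of the block (β , s);
  -- uu γ, vv γ: the endpoints of the last edge in the copy of G with index γ.
  data Vertex : Set where
    kk    : Fin p → Fin (suc fill) → Vertex
    pt    : Fin p → Fin layers → Vertex
    yy    : Fin p → Fin layers → Fin fill → Vertex
    uu vv : Fin p → Vertex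

  Code : Set
  Code = (Fin p × Fin (suc fill)) ⊎ ((Fin p × Fin layers) ⊎ ((Fin p × (Fin layers × Fin fill)) ⊎ (Fin p ⊎ Fin p)))

  order : ℕ
  order = p * suc fill + (p * layers + (p * (layers * fill) + (p + p)))

  vertex↔code : Vertex ↔ Code
  vertex↔code = mk↔ₛ′ to from to-from from-to
    where
    to : Vertex → Code
    to (kk x i)   = inj₁ (x , i)
    to (pt x t)   = inj₂ (inj₁ (x , t))
    to (yy x s l) = inj₂ (inj₂ (inj₁ (x , s , l)))
    to (uu x)     = inj₂ (inj₂ (inj₂ (inj₁ x)))
    to (vv x)     = inj₂ (inj₂ (inj₂ (inj₂ x)))
    from : Code → Vertex
    from (inj₁ (x , i))                      = kk x i
    from (inj₂ (inj₁ (x , t)))               = pt x t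
    from (inj₂ (inj₂ (inj₁ (x , s , l))))    = yy x s l
    from (inj₂ (inj₂ (inj₂ (inj₁ x))))       = uu x
    from (inj₂ (inj₂ (inj₂ (inj₂ x))))       = vv x
    to-from : ∀ c → to (from c) ≡ c
    to-from (inj₁ _)                      = refl
    to-from (inj₂ (inj₁ _))               = refl
    to-from (inj₂ (inj₂ (inj₁ _)))        = refl
    to-from (inj₂ (inj₂ (inj₂ (inj₁ _)))) = refl
    to-from (inj₂ (inj₂ (inj₂ (inj₂ _)))) = refl
    from-to : ∀ x → from (to x) ≡ x
    from-to (kk _ _)   = refl
    from-to (pt _ _)   = refl
    from-to (yy _ _ _) = refl
    from-to (uu _)     = refl
    from-to (vv _)     = refl

  fin↔code : Fin order ↔ Code
  fin↔code =
    (*↔× ⊎-↔ ((*↔× ⊎-↔ ((((↔-id (Fin p) ×-↔ *↔×) ↔-∘ *↔×) ⊎-↔ +↔⊎) ↔-∘ +↔⊎)) ↔-∘ +↔⊎)) ↔-∘ +↔⊎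

  vertex↔fin : Vertex ↔ Fin order
  vertex↔fin = ↔-sym fin↔code ↔-∘ vertex↔code

  open Inverse vertex↔fin public using () renaming (to to enc; from to dec; strictlyInverseˡ to enc-dec; strictlyInverseʳ to dec-enc)

  _≟_ : DecidableEquality Vertex
  x ≟ y = map′ (λ eq → trans (sym (dec-enc x)) (trans (cong dec eq) (dec-enc y))) (cong enc) (enc x Finᵖ.≟ enc y)

  IsPt : Vertex → Set
  IsPt (pt _ _) = ⊤
  IsPt _        = ⊥

  IsPt? : ∀ x → Dec (IsPt x)
  IsPt? (kk _ _)   = no λ ()
  IsPt? (pt _ _)   = yes tt
  IsPt? (yy _ _ _) = no λ ()
  IsPt? (uu _)     = no λ ()
  IsPt? (vv _)     = no λ ()

  place-< : ∀ γ w → gap * suc (toℕ (combine {p} {n} γ w)) < layers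
  place-< γ w = s≤s (ℕᵖ.*-monoʳ-≤ gap (Finᵖ.toℕ<n (combine γ w)))

  place : Fin p → Fin n → Fin layers
  place γ w = fromℕ< (place-< γ w)

  toℕ-place : ∀ γ w → toℕ (place γ w) ≡ gap * suc (toℕ (combine γ w))
  toℕ-place γ w = toℕ-fromℕ< (place-< γ w)

  place-near : ∀ {γ γ′ w w′ D} → toℕ (place γ w) ≤ toℕ (place γ′ w′) + D → toℕ (place γ′ w′) ≤ toℕ (place γ w) + D →
               D < gap → γ ≡ γ′ × w ≡ w′
  place-near {γ} {γ′} {w} {w′} {D} le ge D<gap =
    combine-injective γ w γ′ w′ (toℕ-injective (ℕᵖ.suc-injective
      (ℕᵖ.≤-antisym (*-cancelˡ-near {gap} (subst₂ (λ a b → a ≤ b + D) (toℕ-place γ w) (toℕ-place γ′ w′) le) D<gap)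
                    (*-cancelˡ-near {gap} (subst₂ (λ a b → a ≤ b + D) (toℕ-place γ′ w′) (toℕ-place γ w) ge) D<gap))))

  gap≤place : ∀ γ w → gap ≤ toℕ (place γ w)
  gap≤place γ w = ℕᵖ.≤-trans (ℕᵖ.m≤m*n gap (suc (toℕ (combine γ w)))) (ℕᵖ.≤-reflexive (sym (toℕ-place γ w)))

  -- ρ γ places the copy of G with index γ.
  ρ : Fin p → Fin n → Vertex
  ρ γ w with w Finᵖ.≟ u
  ... | yes _ = uu γ
  ... | no _ with w Finᵖ.≟ v
  ... | yes _ = vv γ
  ... | no _  = pt γ (place γ w)

  data RowView (γ : Fin p) (w : Fin n) : Vertex → Set where
    at-u  : w ≡ u → RowView γ w (uu γ)
    at-v  : w ≡ v → RowView γ w (vv γ)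
    at-pt : w ≢ u → w ≢ v → RowView γ w (pt γ (place γ w))

  rowView : ∀ γ w → RowView γ w (ρ γ w)
  rowView γ w with w Finᵖ.≟ u
  ... | yes w≡u = at-u w≡u
  ... | no w≢u with w Finᵖ.≟ v
  ... | yes w≡v = at-v w≡v
  ... | no w≢v  = at-pt w≢u w≢v

  ρ-u : ∀ γ → ρ γ u ≡ uu γ
  ρ-u γ with ρ γ u | rowView γ u
  ... | _ | at-u _      = refl
  ... | _ | at-v u≡v    = contradiction u≡v u≢v
  ... | _ | at-pt u≢u _ = contradiction refl u≢u

  ρ-v : ∀ γ → ρ γ v ≡ vv γ
  ρ-v γ with ρ γ v | rowView γ v
  ... | _ | at-u v≡u    = contradiction (sym v≡u) u≢v
  ... | _ | at-v _      = refl
  ... | _ | at-pt _ v≢v = contradiction refl v≢v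

  ρ-injective : ∀ γ w γ′ w′ → ρ γ w ≡ ρ γ′ w′ → γ ≡ γ′ × w ≡ w′
  ρ-injective γ w γ′ w′ eq with ρ γ w | rowView γ w | ρ γ′ w′ | rowView γ′ w′
  ρ-injective _ _ _ _ refl | _ | at-u w≡u | _ | at-u w′≡u = refl , trans w≡u (sym w′≡u)
  ρ-injective _ _ _ _ refl | _ | at-v w≡v | _ | at-v w′≡v = refl , trans w≡v (sym w′≡v)
  ρ-injective γ w γ′ w′ eq | _ | at-pt _ _ | _ | at-pt _ _ =
    place-near {D = 0} (ℕᵖ.≤-reflexive (trans layer (sym (ℕᵖ.+-identityʳ _))))
      (ℕᵖ.≤-reflexive (trans (sym layer) (sym (ℕᵖ.+-identityʳ _)))) (s≤s z≤n)
    where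
    layer : toℕ (place γ w) ≡ toℕ (place γ′ w′)
    layer = cong (λ { (pt _ t) → toℕ t ; _ → 0 }) eq

  Label : Set
  Label = Fin (2 + e)

  -- Label zero marks the head of a block, which lies one layer below its children.
  shift : Label → ℕ → ℕ
  shift zero    t = suc t
  shift (suc _) t = t

  record Inc (c : Label) (x : Fin p) (t : Fin layers) (β : Fin p) (s : Fin layers) : Set where
    constructor inc
    field
      point : x ≡ σ c β
      layer : toℕ s ≡ shift c (toℕ t)

  data Mem : Vertex → Fin p → Fin layers → Set where
    pt-mem : ∀ c {x t β s} → Inc c x t β s → Mem (pt x t) β s
    yy-mem : ∀ {β s l} → Mem (yy β s l) β s
    vv-mem : ∀ {β} → Mem (vv β) β zero

  data Attached : Vertex → Vertex → Set where
    k-y : ∀ {γ s l} → toℕ l < e → Attached (kk γ zero) (yy γ s l)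
    k-u : ∀ {γ} → Attached (kk γ zero) (uu γ)
    u-y : ∀ {γ l} → toℕ l < e → Attached (uu γ) (yy γ zero l)

  data Static : Vertex → Vertex → Set where
    core   : ∀ {γ i γ′ i′} → kk γ i ≢ kk γ′ i′ → Static (kk γ i) (kk γ′ i′)
    block  : ∀ {x y β s} → x ≢ y → Mem x β s → Mem y β s → Static x y
    attach : ∀ {x y} → Attached x y → Static x y
    attach⁻  : ∀ {x y} → Attached y x → Static x y

  data E (R : Rel n) : Vertex → Vertex → Set where
    static : ∀ {x y} → Static x y → E R x y
    row    : ∀ γ {w w′ x y} → R w w′ → x ≡ ρ γ w → y ≡ ρ γ w′ → E R x y

  Inc? : ∀ c x t β s → Dec (Inc c x t β s)
  Inc? c x t β s = map′ (λ (a , b) → inc a b) (λ (inc a b) → a , b)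
    ((x Finᵖ.≟ σ c β) ×-dec (toℕ s ℕᵖ.≟ shift c (toℕ t)))

  Mem? : ∀ x β s → Dec (Mem x β s)
  Mem? (kk _ _)   β s = no λ ()
  Mem? (uu _)     β s = no λ ()
  Mem? (pt x t)   β s = map′ (λ (c , i) → pt-mem c i) (λ { (pt-mem c i) → c , i }) (any? λ c → Inc? c x t β s)
  Mem? (yy x t l) β s = map′ (λ { (refl , refl) → yy-mem }) (λ { yy-mem → refl , refl })
    ((x Finᵖ.≟ β) ×-dec (t Finᵖ.≟ s))
  Mem? (vv x)     β s = map′ (λ { (refl , refl) → vv-mem }) (λ { vv-mem → refl , refl })
    ((x Finᵖ.≟ β) ×-dec (zero Finᵖ.≟ s))

  Attached? : ∀ x y → Dec (Attached x y)
  Attached? (kk γ zero) (yy γ′ s l) = map′ (λ { (refl , l<e) → k-y l<e }) (λ { (k-y l<e) → refl , l<e })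
    ((γ Finᵖ.≟ γ′) ×-dec (toℕ l <? e))
  Attached? (kk γ zero) (uu γ′) = map′ (λ { refl → k-u }) (λ { k-u → refl }) (γ Finᵖ.≟ γ′)
  Attached? (uu γ) (yy γ′ zero l) = map′ (λ { (refl , l<e) → u-y l<e }) (λ { (u-y l<e) → refl , l<e })
    ((γ Finᵖ.≟ γ′) ×-dec (toℕ l <? e))
  Attached? (kk _ (suc _)) _ = no λ ()
  Attached? (kk _ zero) (kk _ _) = no λ ()
  Attached? (kk _ zero) (pt _ _) = no λ ()
  Attached? (kk _ zero) (vv _) = no λ ()
  Attached? (uu _) (yy _ (suc _) _) = no λ ()
  Attached? (uu _) (kk _ _) = no λ ()
  Attached? (uu _) (pt _ _) = no λ ()
  Attached? (uu _) (uu _) = no λ ()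
  Attached? (uu _) (vv _) = no λ ()
  Attached? (pt _ _) _ = no λ ()
  Attached? (yy _ _ _) _ = no λ ()
  Attached? (vv _) _ = no λ ()

  IsCore : Vertex → Set
  IsCore (kk _ _) = ⊤
  IsCore _        = ⊥

  IsCore? : ∀ x → Dec (IsCore x)
  IsCore? (kk _ _)   = yes tt
  IsCore? (pt _ _)   = no λ ()
  IsCore? (yy _ _ _) = no λ ()
  IsCore? (uu _)     = no λ ()
  IsCore? (vv _)     = no λ ()

  core′ : ∀ {x y} → IsCore x → IsCore y → x ≢ y → Static x y
  core′ {kk _ _} {kk _ _} _ _ x≢y = core x≢y

  Static? : ∀ x y → Dec (Static x y)
  Static? x y = map′ fwd bwd
    ((¬? (x ≟ y) ×-dec ((IsCore? x ×-dec IsCore? y) ⊎-dec (any? λ β → any? λ s → Mem? x β s ×-dec Mem? y β s)))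
     ⊎-dec (Attached? x y ⊎-dec Attached? y x))
    where
    fwd : (x ≢ y × ((IsCore x × IsCore y) ⊎ Σ _ λ β → Σ _ λ s → Mem x β s × Mem y β s)) ⊎ (Attached x y ⊎ Attached y x) → Static x y
    fwd (inj₁ (x≢y , inj₁ (cx , cy)))             = core′ cx cy x≢y
    fwd (inj₁ (x≢y , inj₂ (_ , _ , mx , my)))     = block x≢y mx my
    fwd (inj₂ (inj₁ a))                           = attach a
    fwd (inj₂ (inj₂ a))                           = attach⁻ a
    bwd : Static x y → (x ≢ y × ((IsCore x × IsCore y) ⊎ Σ _ λ β → Σ _ λ s → Mem x β s × Mem y β s)) ⊎ (Attached x y ⊎ Attached y x)
    bwd (core x≢y)        = inj₁ (x≢y , inj₁ (tt , tt))
    bwd (block x≢y mx my) = inj₁ (x≢y , inj₂ (_ , _ , mx , my))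
    bwd (attach a)        = inj₂ (inj₁ a)
    bwd (attach⁻ a)         = inj₂ (inj₂ a)

  E? : ∀ {R : Rel n} → (∀ w w′ → Dec (R w w′)) → ∀ x y → Dec (E R x y)
  E? R? x y = map′
    (λ { (inj₁ s) → static s ; (inj₂ (γ , w , w′ , r , eq , eq′)) → row γ r eq eq′ })
    (λ { (static s) → inj₁ s ; (row γ r eq eq′) → inj₂ (γ , _ , _ , r , eq , eq′) })
    (Static? x y ⊎-dec any? λ γ → any? λ w → any? λ w′ → R? w w′ ×-dec ((x ≟ ρ γ w) ×-dec (y ≟ ρ γ w′)))

  Static-sym : ∀ {x y} → Static x y → Static y x
  Static-sym (core x≢y)        = core (x≢y ∘ sym)
  Static-sym (block x≢y mx my) = block (x≢y ∘ sym) my mx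
  Static-sym (attach a)        = attach⁻ a
  Static-sym (attach⁻ a)         = attach a

  Static-irrefl : ∀ {x} → ¬ Static x x
  Static-irrefl (core x≢x)      = x≢x refl
  Static-irrefl (block x≢x _ _) = x≢x refl
  Static-irrefl (attach ())
  Static-irrefl (attach⁻ ())

  E-sym : ∀ {R : Rel n} → (∀ {w w′} → R w w′ → R w′ w) → ∀ {x y} → E R x y → E R y x
  E-sym R-sym (static s)       = static (Static-sym s)
  E-sym R-sym (row γ r eq eq′) = row γ (R-sym r) eq′ eq

  E-irrefl : ∀ {R : Rel n} → (∀ {w} → ¬ R w w) → ∀ {x} → ¬ E R x x
  E-irrefl R-irr (static s) = Static-irrefl s
  E-irrefl R-irr (row γ {w} {w′} r eq eq′)
    with refl ← proj₂ (ρ-injective γ w γ w′ (trans (sym eq) eq′)) = R-irr r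

  shift-≤ : ∀ c t → t ≤ shift c t × shift c t ≤ suc t
  shift-≤ zero    t = ℕᵖ.n≤1+n t , ℕᵖ.≤-refl
  shift-≤ (suc _) t = ℕᵖ.≤-refl , ℕᵖ.n≤1+n t

  shift-injective : ∀ c {t t′} → shift c t ≡ shift c t′ → t ≡ t′
  shift-injective zero    = ℕᵖ.suc-injective
  shift-injective (suc _) = λ eq → eq

  Inc-near : ∀ {c c′ x t x′ t′ β s} → Inc c x t β s → Inc c′ x′ t′ β s → toℕ t ≤ suc (toℕ t′)
  Inc-near {c} {c′} {t = t} {t′ = t′} (inc _ eq) (inc _ eq′) =
    ℕᵖ.≤-trans (proj₁ (shift-≤ c (toℕ t))) (ℕᵖ.≤-trans (ℕᵖ.≤-reflexive (trans (sym eq) eq′)) (proj₂ (shift-≤ c′ (toℕ t′))))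

  row-not-first : ∀ {c γ w β} → ¬ Inc c γ (place γ w) β zero
  row-not-first {c} {γ} {w} (inc _ eq) with ℕᵖ.≤-trans (gap≤place γ w) (ℕᵖ.≤-trans (proj₁ (shift-≤ c _)) (ℕᵖ.≤-reflexive (sym eq)))
  ... | ()

  E-row : ∀ {R : Rel n} {γ w w′} → E R (ρ γ w) (ρ γ w′) → R w w′
  E-row {R} {γ} {w} {w′} (row γ′ {w₁} {w₂} r eq eq′)
    with ρ-injective γ w γ′ w₁ eq | ρ-injective γ w′ γ′ w₂ eq′
  ... | refl , refl | _ , refl = r
  E-row {R} {γ} {w} {w′} (static s) = ⊥-elim (not-static (ρ γ w) (ρ γ w′) refl refl s)
    where
    not-static : ∀ x y → x ≡ ρ γ w → y ≡ ρ γ w′ → ¬ Static x y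
    not-static x y x≡ y≡ s with ρ γ w | rowView γ w | ρ γ w′ | rowView γ w′
    not-static x y refl refl (block x≢y (pt-mem c i) (pt-mem c′ i′)) | _ | at-pt _ _ | _ | at-pt _ _ =
      x≢y (cong (pt γ ∘ place γ) (proj₂ (place-near {γ} {γ} {w} {w′} {1}
        (ℕᵖ.≤-trans (Inc-near i i′) (ℕᵖ.≤-reflexive (ℕᵖ.+-comm 1 _)))
        (ℕᵖ.≤-trans (Inc-near i′ i) (ℕᵖ.≤-reflexive (ℕᵖ.+-comm 1 _))) (s≤s (s≤s z≤n)))))
    not-static x y refl refl (block x≢y (pt-mem c i) vv-mem) | _ | at-pt _ _ | _ | at-v _ = row-not-first i
    not-static x y refl refl (block x≢y vv-mem (pt-mem c i)) | _ | at-v _ | _ | at-pt _ _ = row-not-first i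
    not-static x y refl refl (block x≢y vv-mem vv-mem) | _ | at-v _ | _ | at-v _ = x≢y refl
    not-static x y refl refl (attach ()) | _ | at-v _ | _ | _
    not-static x y refl refl (attach ()) | _ | at-pt _ _ | _ | _
    not-static x y refl refl (attach ()) | _ | at-u _ | _ | at-u _
    not-static x y refl refl (attach ()) | _ | at-u _ | _ | at-v _
    not-static x y refl refl (attach ()) | _ | at-u _ | _ | at-pt _ _
    not-static x y refl refl (attach⁻ ()) | _ | _ | _ | at-v _
    not-static x y refl refl (attach⁻ ()) | _ | _ | _ | at-pt _ _
    not-static x y refl refl (attach⁻ ()) | _ | at-u _ | _ | at-u _
    not-static x y refl refl (attach⁻ ()) | _ | at-v _ | _ | at-u _
    not-static x y refl refl (attach⁻ ()) | _ | at-pt _ _ | _ | at-u _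

-- Leaf blocks

module Blocks (h e n : ℕ) (Φ : FreeInvolutions (2 + e) (2 + (h + h))) (u v : Fin n) (u≢v : u ≢ v) where

  open Construction h e n Φ u v u≢v public

  -- A block of the first layer is enlarged by its copy of G.
  XMem : Vertex → Fin p → Fin layers → Set
  XMem x β s = Mem x β s ⊎ (s ≡ zero × Σ (Fin n) λ w → x ≡ ρ β w)

  XMem? : ∀ x β s → Dec (XMem x β s)
  XMem? x β s = Mem? x β s ⊎-dec ((s Finᵖ.≟ zero) ×-dec any? λ w → x ≟ ρ β w)

  home : Vertex → Fin p × Fin layers
  home (kk γ _)   = γ , zero
  home (pt x t)   = x , t
  home (yy β s _) = β , s
  home (uu γ)     = γ , zero
  home (vv γ)     = γ , zero

  home-XMem : ∀ {x β s} → ¬ IsPt x → XMem x β s → home x ≡ (β , s)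
  home-XMem ¬pt (inj₁ (pt-mem _ _)) = contradiction tt ¬pt
  home-XMem ¬pt (inj₁ yy-mem)       = refl
  home-XMem ¬pt (inj₁ vv-mem)       = refl
  home-XMem {β = β} ¬pt (inj₂ (refl , w , refl)) with ρ β w | rowView β w
  ... | _ | at-u _    = refl
  ... | _ | at-v _    = refl
  ... | _ | at-pt _ _ = contradiction tt ¬pt

  XMem-private : ∀ {x β s β′ s′} → ¬ IsPt x → XMem x β s → XMem x β′ s′ → β′ ≡ β × s′ ≡ s
  XMem-private ¬pt m m′ with trans (sym (home-XMem ¬pt m)) (home-XMem ¬pt m′)
  ... | refl = refl , refl

  XMem-¬core : ∀ {x β s} → XMem x β s → ¬ IsCore x
  XMem-¬core {kk _ _} (inj₁ ())
  XMem-¬core {kk γ i} {β} (inj₂ (_ , w , eq)) _ with ρ β w | rowView β w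
  XMem-¬core {kk γ i} {β} (inj₂ (_ , w , ())) _ | _ | at-u _
  XMem-¬core {kk γ i} {β} (inj₂ (_ , w , ())) _ | _ | at-v _
  XMem-¬core {kk γ i} {β} (inj₂ (_ , w , ())) _ | _ | at-pt _ _

  uu-XMem : ∀ γ → XMem (uu γ) γ zero
  uu-XMem γ = inj₂ (refl , u , sym (ρ-u γ))

  hasBlock : ∀ x → ¬ IsCore x → Σ (Fin p) λ β → Σ (Fin layers) (XMem x β)
  hasBlock (kk _ _)   ¬core = contradiction tt ¬core
  hasBlock (pt x t)   _     = σ (suc zero) x , t , inj₁ (pt-mem (suc zero) (inc (sym (invol (suc zero) x)) refl))
  hasBlock (yy β s _) _     = β , s , inj₁ yy-mem
  hasBlock (uu γ)     _     = γ , zero , uu-XMem γ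
  hasBlock (vv γ)     _     = γ , zero , inj₁ vv-mem

  edge-block : ∀ {R : Rel n} {x y} → E R x y → ¬ IsCore x →
    Σ (Fin p) λ β → Σ (Fin layers) λ s → XMem x β s × (XMem y β s ⊎ (¬ IsPt x × y ≡ kk β zero))
  edge-block (row γ {w} {w′} r eq eq′)      _  = γ , zero , inj₂ (refl , w , eq) , inj₁ (inj₂ (refl , w′ , eq′))
  edge-block (static (core _))              ¬c = contradiction tt ¬c
  edge-block (static (block _ mx my))       _  = _ , _ , inj₁ mx , inj₁ (inj₁ my)
  edge-block (static (attach (k-y _)))      ¬c = contradiction tt ¬c
  edge-block (static (attach k-u))          ¬c = contradiction tt ¬c
  edge-block (static (attach (u-y _)))      _  = _ , _ , uu-XMem _ , inj₁ (inj₁ yy-mem)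
  edge-block (static (attach⁻ (k-y _)))       _  = _ , _ , inj₁ yy-mem , inj₂ ((λ ()) , refl)
  edge-block (static (attach⁻ k-u))           _  = _ , _ , uu-XMem _ , inj₂ ((λ ()) , refl)
  edge-block (static (attach⁻ (u-y _)))       _  = _ , _ , inj₁ yy-mem , inj₁ (uu-XMem _)

  data Path : Fin p → Fin layers → List Label → Fin p → Fin layers → Set where
    []   : ∀ {x t} → Path x t [] x t
    via : ∀ {c c′ x t β s x′ t′ w y r} → Inc c x t β s → Inc c′ x′ t′ β s → Path x′ t′ w y r →
           Path x t (c ∷ c′ ∷ w) y r

  path-act : ∀ {x t w y r} → Path x t w y r → act σ w x ≡ y
  path-act []                                   = refl
  path-act (via {c} {c′} {w = w} (inc refl _) (inc refl _) π) = trans (cong (act σ w ∘ σ c′) (invol c _)) (path-act π)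

  path-layer : ∀ {x t w y r} → Path x t w y r → toℕ t ≤ toℕ r + length w × toℕ r ≤ toℕ t + length w
  path-layer {t = t} [] = ℕᵖ.m≤m+n (toℕ t) 0 , ℕᵖ.m≤m+n (toℕ t) 0
  path-layer {t = t} {r = r} (via {t′ = t′} {w = w} i i′ π) = let t′≤r , r≤t′ = path-layer π in
    (begin
      toℕ t                          ≤⟨ Inc-near i i′ ⟩
      suc (toℕ t′)                   ≤⟨ s≤s t′≤r ⟩
      suc (toℕ r + length w)         ≤⟨ ℕᵖ.n≤1+n _ ⟩
      2 + (toℕ r + length w)         ≡⟨ move (toℕ r) ⟩
      toℕ r + (2 + length w)         ∎) ,
    (begin
      toℕ r                          ≤⟨ r≤t′ ⟩
      toℕ t′ + length w              ≤⟨ ℕᵖ.+-monoˡ-≤ (length w) (Inc-near i′ i) ⟩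
      suc (toℕ t) + length w         ≤⟨ ℕᵖ.n≤1+n _ ⟩
      2 + (toℕ t + length w)         ≡⟨ move (toℕ t) ⟩
      toℕ t + (2 + length w)         ∎)
    where
    open ℕᵖ.≤-Reasoning
    move : ∀ a → 2 + (a + length w) ≡ a + (2 + length w)
    move a = sym (trans (ℕᵖ.+-suc a (suc (length w))) (cong suc (ℕᵖ.+-suc a (length w))))

  path-open : ∀ {c x t w y r} → Path x t (c ∷ w) y r → Reduced (c ∷ w) → length (c ∷ w) ≤ 2 + (h + h) → y ≢ x
  path-open {c} {x} {w = w} π red len y≡x = free c w red len x (trans (path-act π) y≡x)

  Inc-label-≢ : ∀ {c c′ x t x′ t′ β s} → Inc c x t β s → Inc c′ x′ t′ β s → pt x′ t′ ≢ pt x t → c′ ≢ c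
  Inc-label-≢ {c} (inc refl l) (inc refl l′) pt≢ refl =
    pt≢ (cong (pt _) (toℕ-injective (shift-injective c (trans (sym l′) l))))

  Inc-block-≢ : ∀ {c c′ x t β s β′ s′} → Inc c x t β s → Inc c′ x t β′ s′ → ¬ (β′ ≡ β × s′ ≡ s) → c′ ≢ c
  Inc-block-≢ {c} (inc x≡ l) (inc x≡′ l′) b≢ refl = b≢
    ( trans (sym (invol c _)) (trans (cong (σ c) (trans (sym x≡′) x≡)) (invol c _))
    , toℕ-injective (trans l′ (sym l)) )

module LeafSearch (h e n : ℕ) (Φ : FreeInvolutions (2 + e) (2 + (h + h))) (u v : Fin n) (u≢v : u ≢ v) where

  open Blocks h e n Φ u v u≢v

  module _ (φ : Fin h → Vertex) (φ-inj : ∀ {b c} → φ b ≡ φ c → b ≡ c) where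

    Leaf : Fin p → Fin layers → Vertex → Set
    Leaf β s z = ∀ c → XMem (φ c) β s → φ c ≢ z → ∀ β′ s′ → ¬ (β′ ≡ β × s′ ≡ s) → XMem (φ c) β′ s′ →
                 ∀ c′ → XMem (φ c′) β′ s′ → c′ ≡ c

    LeafAt : Set
    LeafAt = Σ (Fin p) λ β → Σ (Fin layers) λ s → Σ Vertex λ z →
      (XMem z β s ⊎ z ≡ kk β zero) × Leaf β s z × Σ (Fin h) λ c → XMem (φ c) β s × φ c ≢ z

    Branch : Fin p → Fin layers → Vertex → Set
    Branch β s z = Σ (Fin h) λ c → XMem (φ c) β s × φ c ≢ z × Σ (Fin p) λ β′ → Σ (Fin layers) λ s′ →
      ¬ (β′ ≡ β × s′ ≡ s) × XMem (φ c) β′ s′ × Σ (Fin h) λ c′ → c′ ≢ c × XMem (φ c′) β′ s′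

    Branch? : ∀ β s z → Dec (Branch β s z)
    Branch? β s z = any? λ c → XMem? (φ c) β s ×-dec (¬? (φ c ≟ z) ×-dec any? λ β′ → any? λ s′ →
      ¬? ((β′ Finᵖ.≟ β) ×-dec (s′ Finᵖ.≟ s)) ×-dec (XMem? (φ c) β′ s′ ×-dec any? λ c′ →
      ¬? (c′ Finᵖ.≟ c) ×-dec XMem? (φ c′) β′ s′))

    ¬Branch⇒Leaf : ∀ {β s z} → ¬ Branch β s z → Leaf β s z
    ¬Branch⇒Leaf ¬br c m c≢z β′ s′ b≢ m′ c′ mc′ = decidable-stable (c′ Finᵖ.≟ c) λ c′≢c →
      ¬br (c , m , c≢z , β′ , s′ , b≢ , m′ , c′ , c′≢c , mc′)

    -- Walks never pass through a copy of G: they start at a point of a copy, away from it, and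
    -- the other points of copies are too far, or no point of a copy is a branching point (NoRow).
    NoRow : Set
    NoRow = ∀ c γ w → φ c ≡ ρ γ w → ∀ β s → Mem (φ c) β s → IsPt (φ c) → ∀ c′ → XMem (φ c′) β s → c′ ≡ c

    RowBranch : Set
    RowBranch = Σ (Fin h) λ c → Σ (Fin p) λ γ → Σ (Fin n) λ w → φ c ≡ ρ γ w × Σ (Fin p) λ β → Σ (Fin layers) λ s →
      Mem (φ c) β s × IsPt (φ c) × Σ (Fin h) λ c′ → c′ ≢ c × XMem (φ c′) β s

    RowBranch? : Dec RowBranch
    RowBranch? = any? λ c → any? λ γ → any? λ w → (φ c ≟ ρ γ w) ×-dec any? λ β → any? λ s →
      Mem? (φ c) β s ×-dec (IsPt? (φ c) ×-dec any? λ c′ → ¬? (c′ Finᵖ.≟ c) ×-dec XMem? (φ c′) β s)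

    ¬RowBranch⇒NoRow : ¬ RowBranch → NoRow
    ¬RowBranch⇒NoRow ¬rb c γ w eq β s m ip c′ m′ = decidable-stable (c′ Finᵖ.≟ c) λ c′≢c →
      ¬rb (c , γ , w , eq , β , s , m , ip , c′ , c′≢c , m′)

    asPoint : ∀ {c β s β′ s′} → XMem (φ c) β s → XMem (φ c) β′ s′ → ¬ (β′ ≡ β × s′ ≡ s) →
              Σ (Fin p) λ x → Σ (Fin layers) λ t → φ c ≡ pt x t
    asPoint {c} m m′ b≢ with φ c
    ... | kk _ _   = contradiction (XMem-private (λ ()) m m′) b≢
    ... | pt x t   = x , t , refl
    ... | yy _ _ _ = contradiction (XMem-private (λ ()) m m′) b≢
    ... | uu _     = contradiction (XMem-private (λ ()) m m′) b≢
    ... | vv _     = contradiction (XMem-private (λ ()) m m′) b≢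

    pt-label : ∀ {y x t β s} → y ≡ pt x t → Mem y β s → Σ Label λ c → Inc c x t β s
    pt-label refl (pt-mem c i) = c , i

    Labels : Fin p → Fin layers → Fin p → Fin layers → Fin p → Fin layers → Set
    Labels x t β s β′ s′ = (Σ Label λ c → Inc c x t β s) × (Σ Label λ c → Inc c x t β′ s′)

    other : ∀ {c c₁ c₂ : Fin h} {P : Fin h → Set} → c₁ ≢ c₂ → P c₁ → P c₂ → Σ (Fin h) λ d → d ≢ c × P d
    other {c} {c₁} {c₂} c₁≢c₂ p₁ p₂ with c₁ Finᵖ.≟ c
    ... | yes refl = c₂ , (λ eq → c₁≢c₂ (sym eq)) , p₂
    ... | no c₁≢c  = c₁ , c₁≢c , p₁

    labels-noRow : NoRow → ∀ {c x t β s β′ s′} → φ c ≡ pt x t → XMem (φ c) β s → XMem (φ c) β′ s′ →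
      ¬ (β′ ≡ β × s′ ≡ s) → (Σ (Fin h) λ d → d ≢ c × XMem (φ d) β s) → (Σ (Fin h) λ d → d ≢ c × XMem (φ d) β′ s′) →
      Labels x t β s β′ s′
    labels-noRow noRow {c} eq m m′ b≢ (d , d≢c , md) (d′ , d′≢c , md′) = aux m m′
      where
      isPt : IsPt (φ c)
      isPt = subst IsPt (sym eq) tt
      aux : XMem (φ c) _ _ → XMem (φ c) _ _ → Labels _ _ _ _ _ _
      aux (inj₁ m)            (inj₁ m′)           = pt-label eq m , pt-label eq m′
      aux (inj₁ m)            (inj₂ (_ , w , r))  = contradiction (noRow c _ w r _ _ m isPt d md) d≢c
      aux (inj₂ (_ , w , r))  (inj₁ m′)           = contradiction (noRow c _ w r _ _ m′ isPt d′ md′) d′≢c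
      aux (inj₂ (s≡ , w , r)) (inj₂ (s′≡ , w′ , r′)) = contradiction
        (sym (proj₁ (ρ-injective _ w _ w′ (trans (sym r) r′))) , trans s′≡ (sym s≡)) b≢

    -- The walk has left the point (x , t) through the label cz; Back leads to a point visited earlier.
    Back : Fin p → Fin layers → Label → ℕ → Fin h → Set
    Back x t cz N c = Σ (Fin p) λ y → Σ (Fin layers) λ r → Σ (List Label) λ w →
      φ c ≡ pt y r × Path x t w y r × Reduced (cz ∷ w) × length w ≤ N + N

    Safe : List (Fin h) → Set
    Safe vs = (Σ (Fin h) λ c → c ∈ vs × Σ (Fin p) λ γ → Σ (Fin n) λ w → φ c ≡ ρ γ w) ⊎ NoRow

    row-layer : ∀ {γ w x t} → pt x t ≡ ρ γ w → x ≡ γ × toℕ t ≡ toℕ (place γ w)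
    row-layer {γ} {w} eq with ρ γ w | rowView γ w
    row-layer refl | _ | at-pt _ _ = refl , refl

    visited≤h : ∀ {vs : List (Fin h)} → Unique vs → length vs ≤ h
    visited≤h vs! = ℕᵖ.≤-trans (Unique-⊆⇒length≤ vs! (λ _ → ∈-allFin _)) (ℕᵖ.≤-reflexive (length-tabulate {n = h} (λ i → i)))

    walk : ∀ fuel vs → Unique vs → length vs + fuel ≡ suc h →
           ∀ {β s x t cz a} → Inc cz x t β s → φ a ≡ pt x t →
           ∀ c₁ → XMem (φ c₁) β s → φ c₁ ≢ pt x t →
           (∀ {c} → c ∈ vs → Back x t cz (length vs) c) → a ∈ vs → Safe vs → LeafAt
    walk zero vs vs! len _ _ _ _ _ _ _ _ = contradiction
      (ℕᵖ.≤-trans (ℕᵖ.≤-reflexive (trans (sym len) (ℕᵖ.+-identityʳ _))) (visited≤h vs!)) (ℕᵖ.n≮n h)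
    walk (suc fuel) vs vs! len {β} {s} {x} {t} {cz} {a} iz a≡ c₁ mc₁ c₁≢z back a∈ safe with Branch? β s (pt x t)
    ... | no ¬br = β , s , pt x t , inj₁ (inj₁ (pt-mem cz iz)) , ¬Branch⇒Leaf ¬br , c₁ , mc₁ , c₁≢z
    ... | yes (c , m , c≢z , β′ , s′ , b≢ , m′ , c′ , c′≢c , mc′) = next (asPoint m m′ b≢)
      where
      short : ∀ {k} → k ≤ length vs + length vs → k ≤ h + h
      short le = ℕᵖ.≤-trans le (ℕᵖ.+-mono-≤ (visited≤h vs!) (visited≤h vs!))

      mz : XMem (φ a) β s
      mz = subst (λ y → XMem y β s) (sym a≡) (inj₁ (pt-mem cz iz))

      fresh : ∀ {x′ t′ l} → φ c ≡ pt x′ t′ → Inc l x′ t′ β s → c ∉ vs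
      fresh {l = l} eq i c∈ with back c∈
      ... | y , r , w , eq′ , π , red , le = path-open (via i iz π)
        (Inc-label-≢ iz i (λ q → c≢z (trans eq q)) ∷ red) (s≤s (s≤s (short le))) (pt-inj (trans (sym eq′) eq))
        where
        pt-inj : ∀ {a b c d} → pt a b ≡ pt c d → a ≡ c
        pt-inj refl = refl

      labels : ∀ {x′ t′} → φ c ≡ pt x′ t′ → Labels x′ t′ β s β′ s′
      labels eq = labels′ safe
        where
        labels′ : Safe vs → Labels _ _ β s β′ s′
        labels′ (inj₂ noRow) = labels-noRow noRow eq m m′ b≢ (a , (λ a≡c → c≢z (trans (cong φ (sym a≡c)) a≡)) , mz) (c′ , c′≢c , mc′)
        labels′ (inj₁ (c₀ , c₀∈ , γ , w₀ , row₀)) with back c₀∈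
        ... | y , r , w , eq₀ , π , red , le = aux (subst (λ q → XMem q β s) eq m) (subst (λ q → XMem q β′ s′) eq m′)
          where
          r≡ : y ≡ γ × toℕ r ≡ toℕ (place γ w₀)
          r≡ = row-layer (trans (sym eq₀) row₀)
          aux : XMem (pt _ _) β s → XMem (pt _ _) β′ s′ → Labels _ _ β s β′ s′
          aux (inj₁ (pt-mem l i)) (inj₁ (pt-mem l′ i′)) = (l , i) , (l′ , i′)
          aux (inj₂ (refl , _)) _ = contradiction
            (begin
              gap                      ≤⟨ gap≤place γ w₀ ⟩
              toℕ (place γ w₀)         ≡⟨ sym (proj₂ r≡) ⟩
              toℕ r                    ≤⟨ proj₂ (path-layer π) ⟩
              toℕ t + length w         ≤⟨ ℕᵖ.+-mono-≤ (proj₁ (shift-≤ cz (toℕ t))) (short le) ⟩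
              shift cz (toℕ t) + (h + h) ≡⟨ cong (_+ (h + h)) (sym (Inc.layer iz)) ⟩
              h + h                    ∎)
            (ℕᵖ.<⇒≱ (ℕᵖ.m≤n⇒m≤1+n (ℕᵖ.n≤1+n _)))
            where open ℕᵖ.≤-Reasoning
          aux (inj₁ (pt-mem l i)) (inj₂ (refl , w′ , eq′)) = contradiction
            (subst (_∈ vs) (φ-inj (trans row₀ (trans (ρ-cong same) (sym (trans eq eq′))))) c₀∈) (fresh eq i)
            where
            close = path-layer (via i iz π)
            here′ = row-layer eq′
            ρ-cong : γ ≡ β′ × w₀ ≡ w′ → ρ γ w₀ ≡ ρ β′ w′
            ρ-cong (refl , refl) = refl
            wide : ∀ k → k + (2 + length w) ≤ k + (2 + (h + h))
            wide k = ℕᵖ.+-monoʳ-≤ k (s≤s (s≤s (short le)))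
            same : γ ≡ β′ × w₀ ≡ w′
            same = place-near {D = 2 + (h + h)}
              (subst₂ (λ p q → p ≤ q + (2 + (h + h))) (proj₂ r≡) (proj₂ here′) (ℕᵖ.≤-trans (proj₂ close) (wide _)))
              (subst₂ (λ p q → p ≤ q + (2 + (h + h))) (proj₂ here′) (proj₂ r≡) (ℕᵖ.≤-trans (proj₁ close) (wide _)))
              ℕᵖ.≤-refl

      next : (Σ (Fin p) λ x′ → Σ (Fin layers) λ t′ → φ c ≡ pt x′ t′) → LeafAt
      next (x′ , t′ , eq) with labels eq
      ... | (l , i) , (l′ , i′) = walk fuel (c ∷ vs)
        (All.tabulate (λ d∈ c≡d → fresh eq i (subst (_∈ vs) (sym c≡d) d∈)) ∷ vs!)
        (trans (sym (ℕᵖ.+-suc (length vs) fuel)) len)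
        i′ eq c′ mc′ (λ q → c′≢c (φ-inj (trans q (sym eq)))) back′ (here refl) (safe′ safe)
        where
        safe′ : Safe vs → Safe (c ∷ vs)
        safe′ (inj₁ (c₀ , c₀∈ , row₀)) = inj₁ (c₀ , there c₀∈ , row₀)
        safe′ (inj₂ noRow)             = inj₂ noRow
        l′≢l : l′ ≢ l
        l′≢l = Inc-block-≢ i i′ b≢
        back′ : ∀ {d} → d ∈ c ∷ vs → Back x′ t′ l′ (suc (length vs)) d
        back′ (here refl) = x′ , t′ , [] , eq , [] , [-] , z≤n
        back′ (there d∈) with back d∈
        ... | y , r , w , eqd , π , red , le = y , r , l ∷ cz ∷ w , eqd , via i iz π ,
              l′≢l ∷ Inc-label-≢ iz i (λ q → c≢z (trans eq q)) ∷ red ,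
              ℕᵖ.≤-trans (s≤s (s≤s le)) (ℕᵖ.≤-reflexive (cong suc (sym (ℕᵖ.+-suc (length vs) (length vs)))))

    begin-walk : ∀ {β s x t cz a} → Inc cz x t β s → φ a ≡ pt x t →
                 ∀ c₁ → XMem (φ c₁) β s → c₁ ≢ a → Safe (a ∷ []) → LeafAt
    begin-walk {a = a} iz a≡ c₁ mc₁ c₁≢a safe = walk h (a ∷ []) ([] ∷ []) refl iz a≡ c₁ mc₁
      (λ q → c₁≢a (φ-inj (trans q (sym a≡))))
      (λ { (here refl) → _ , _ , [] , a≡ , [] , [-] , z≤n }) (here refl) safe

    Multi? : Dec (Σ (Fin p) λ β → Σ (Fin layers) λ s → Σ (Fin h) λ c → Σ (Fin h) λ c′ → c ≢ c′ × XMem (φ c) β s × XMem (φ c′) β s)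
    Multi? = any? λ β → any? λ s → any? λ c → any? λ c′ →
      ¬? (c Finᵖ.≟ c′) ×-dec (XMem? (φ c) β s ×-dec XMem? (φ c′) β s)

    findLeaf : ∀ c → ¬ IsCore (φ c) → LeafAt
    findLeaf c ¬core with RowBranch?
    ... | yes (a , γ , w , eq , β , s , m , ip , c′ , c′≢a , mc′) = start (φ a) refl m
      where
      start : ∀ y → φ a ≡ y → Mem y β s → LeafAt
      start (pt x t) a≡ (pt-mem cz iz) = begin-walk iz a≡ c′ mc′ c′≢a (inj₁ (a , here refl , γ , w , eq))
      start (yy _ _ _) a≡ _ = ⊥-elim (subst IsPt a≡ ip)
      start (vv _) a≡ _ = ⊥-elim (subst IsPt a≡ ip)
    ... | no ¬rb with Multi?
    ... | no ¬multi = let β , s , m = hasBlock (φ c) ¬core in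
      β , s , kk β zero , inj₂ refl ,
      (λ c₁ _ _ β′ s′ _ m′ c₂ m₂ → decidable-stable (c₂ Finᵖ.≟ c₁) λ c₂≢c₁ → ¬multi (β′ , s′ , c₂ , c₁ , c₂≢c₁ , m₂ , m′)) ,
      c , m , λ eq → XMem-¬core m (subst IsCore (sym eq) tt)
    ... | yes (β , s , c₁ , c₂ , c₁≢c₂ , m₁ , m₂) with Branch? β s (kk β zero)
    ... | no ¬br = β , s , kk β zero , inj₂ refl , ¬Branch⇒Leaf ¬br , c₁ , m₁ , λ eq → XMem-¬core m₁ (subst IsCore (sym eq) tt)
    ... | yes (a , m , _ , β′ , s′ , b≢ , m′ , c′ , c′≢a , mc′) with asPoint m m′ b≢
    ... | x , t , a≡ with labels-noRow (¬RowBranch⇒NoRow ¬rb) a≡ m m′ b≢ (other {P = λ d → XMem (φ d) β s} c₁≢c₂ m₁ m₂) (c′ , c′≢a , mc′)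
    ... | _ , (cz , iz) = begin-walk iz a≡ c′ mc′ c′≢a (inj₂ (¬RowBranch⇒NoRow ¬rb))

-- Copies of H stay inside blocks

module Confinement {h : ℕ} (H : Graph h) (insep : ¬ Separable21 H) {e : ℕ} (e≤deg : ∀ a → 2 + e ≤ deg H a)
  {n : ℕ} (Φ : FreeInvolutions (2 + e) (2 + (h + h))) (u v : Fin n) (u≢v : u ≢ v) where

  open Blocks h e n Φ u v u≢v
  open LeafSearch h e n Φ u v u≢v

  ylist : Fin p → Fin layers → List Vertex
  ylist β s = tabulate {n = e} λ i → yy β s (inject≤ i e≤fill)

  length-ylist : ∀ β s → length (ylist β s) ≡ e
  length-ylist β s = length-tabulate {n = e} _

  ∈-ylist : ∀ {β s l} → toℕ l < e → yy β s l ∈ ylist β s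
  ∈-ylist {β} {s} {l} l<e = subst (λ i → yy β s i ∈ ylist β s)
    (toℕ-injective (trans (Finᵖ.toℕ-inject≤ (fromℕ< l<e) e≤fill) (Finᵖ.toℕ-fromℕ< l<e)))
    (∈-tabulate⁺ (fromℕ< l<e))

  data KNbr (γ : Fin p) : Vertex → Set where
    nb-core : ∀ {x} → IsCore x → KNbr γ x
    nb-y    : ∀ {s l} → toℕ l < e → KNbr γ (yy γ s l)
    nb-u    : KNbr γ (uu γ)

  ρ-¬core : ∀ γ w → ¬ IsCore (ρ γ w)
  ρ-¬core γ w = XMem-¬core {s = zero} (inj₂ (refl , w , refl))

  kk-nbr : ∀ {R : Rel n} {γ x} → E R (kk γ zero) x → KNbr γ x
  kk-nbr (row γ {w} _ eq _) = contradiction (subst IsCore eq tt) (ρ-¬core γ w)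
  kk-nbr (static (core _))             = nb-core tt
  kk-nbr (static (attach (k-y l<e)))   = nb-y l<e
  kk-nbr (static (attach k-u))         = nb-u

  data UNbr (R : Rel n) (γ : Fin p) : Vertex → Set where
    nb-k   : UNbr R γ (kk γ zero)
    nb-y   : ∀ {l} → toℕ l < e → UNbr R γ (yy γ zero l)
    nb-row : ∀ {w} → R u w → UNbr R γ (ρ γ w)

  uu-nbr : ∀ {R : Rel n} {γ x} → E R (uu γ) x → UNbr R γ x
  uu-nbr {R} {γ} (row γ′ {w} {w′} r₀ eq refl) with ρ-injective γ u γ′ w (trans (ρ-u γ) eq)
  ... | refl , refl = nb-row r₀
  uu-nbr (static (attach (u-y l<e))) = nb-y l<e
  uu-nbr (static (attach⁻ k-u))        = nb-k

  module _ {R : Rel n} (¬Ruv : ¬ R u v)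
    {φ : Fin h → Vertex} (φ-inj : ∀ {b c} → φ b ≡ φ c → b ≡ c)
    {a₀ b₀ : Fin h} (a₀b₀ : adj H a₀ b₀ ≡ true)
    (kept : ∀ {c d} → adj H c d ≡ true → NotRemoved (just (a₀ , b₀)) c d → E R (φ c) (φ d)) where

    Outcome : Set
    Outcome = E R (φ a₀) (φ b₀) ⊎ Σ (Fin p) λ γ → Σ (Fin h → Fin n) λ ψ → ∀ c → φ c ≡ ρ γ (ψ c)

    adj-≢ : ∀ {c d} → adj H c d ≡ true → c ≢ d
    adj-≢ {c} cd refl = irrefl H c cd

    a₀≢b₀ : φ a₀ ≢ φ b₀
    a₀≢b₀ = adj-≢ a₀b₀ ∘ φ-inj

    data Partner : Fin h → Fin h → Set where
      fst : Partner a₀ b₀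
      snd : Partner b₀ a₀

    deg-partner : ∀ {a b} → Partner a b → ∀ (L : List Vertex) →
      (∀ {c} → adj H a c ≡ true → NotRemoved (just (a₀ , b₀)) a c → φ c ∈ L) → 2 + e ≤ suc (length L)
    deg-partner {a} {b} pr L into = ℕᵖ.≤-trans (e≤deg a) (deg≤length H {φ = φ} {L = φ b ∷ L} φ-inj split)
      where
      keep : ∀ {a b c} → Partner a b → c ≢ b → NotRemoved (just (a₀ , b₀)) a c
      keep fst c≢b (inj₁ (_ , c≡b))   = c≢b c≡b
      keep fst c≢b (inj₂ (a≡b , _))   = adj-≢ a₀b₀ a≡b
      keep snd c≢a (inj₁ (b≡a , _))   = adj-≢ a₀b₀ (sym b≡a)
      keep snd c≢a (inj₂ (_ , c≡a))   = c≢a c≡a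
      split : ∀ c → adj H a c ≡ true → φ c ∈ φ b ∷ L
      split c ac with c Finᵖ.≟ b
      ... | yes refl = here refl
      ... | no c≢b   = there (into ac (keep pr c≢b))

    deg-other : ∀ {a} → a ≢ a₀ → a ≢ b₀ → ∀ (L : List Vertex) →
      (∀ {c} → adj H a c ≡ true → NotRemoved (just (a₀ , b₀)) a c → φ c ∈ L) → 2 + e ≤ length L
    deg-other {a} a≢a₀ a≢b₀ L into = ℕᵖ.≤-trans (e≤deg a) (deg≤length H φ-inj λ c ac →
      into ac λ { (inj₁ (q , _)) → a≢a₀ q ; (inj₂ (q , _)) → a≢b₀ q })

    too-few : ∀ β s → ¬ (2 + e ≤ suc (length (ylist β s)))
    too-few β s le = ℕᵖ.n≮n (suc e) (ℕᵖ.≤-trans le (ℕᵖ.≤-reflexive (cong suc (length-ylist β s))))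

    confined : ∀ β s z → (XMem z β s ⊎ z ≡ kk β zero) → Leaf φ φ-inj β s z →
               ∀ c → XMem (φ c) β s → φ c ≢ z → ∀ d → XMem (φ d) β s ⊎ φ d ≡ kk β zero
    confined β s z z∈ leaf c m c≢z d with φ d ≟ z | φ d ≟ kk β zero
    ... | _        | yes d≡k = inj₂ d≡k
    ... | yes refl | no d≢k  = inj₁ (inBlock z∈)
      where
      inBlock : (XMem (φ d) β s ⊎ φ d ≡ kk β zero) → XMem (φ d) β s
      inBlock (inj₁ m)  = m
      inBlock (inj₂ eq) = contradiction eq d≢k
    ... | no d≢z | no d≢k = inj₁ (spread-off₂ H _≟_ φ-inj insep {a₀} {b₀} z (kk β zero)
          (λ x → XMem? (φ x) β s) closed c≢z (λ eq → XMem-¬core m (subst IsCore (sym eq) tt)) m d≢z d≢k)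
      where
      closed : ∀ {x y} → XMem (φ x) β s → adj H x y ≡ true → NotRemoved (just (a₀ , b₀)) x y →
               φ x ≢ z → φ y ≢ z → φ y ≢ kk β zero → XMem (φ y) β s
      closed {x} {y} mx xy keep x≢z _ y≢k with edge-block (kept xy keep) (XMem-¬core mx)
      ... | β′ , s′ , mx′ , my with (β′ Finᵖ.≟ β) ×-dec (s′ Finᵖ.≟ s)
      closed mx xy keep x≢z _ y≢k | β′ , s′ , mx′ , inj₁ my         | yes (refl , refl) = my
      closed mx xy keep x≢z _ y≢k | β′ , s′ , mx′ , inj₂ (_ , y≡k)  | yes (refl , refl) = contradiction y≡k y≢k
      closed mx xy keep x≢z _ y≢k | β′ , s′ , mx′ , inj₂ (¬pt , _)  | no b≢ = contradiction (XMem-private ¬pt mx mx′) b≢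
      closed {x} {y} mx xy keep x≢z _ y≢k | β′ , s′ , mx′ , inj₁ my | no b≢ =
        contradiction (sym (leaf x mx x≢z β′ s′ b≢ mx′ y my)) (adj-≢ xy)

    -- In a block above the first layer kk β zero has only e neighbours, too few for a vertex of H.
    upper : ∀ β s → s ≢ zero → (∀ d → XMem (φ d) β s ⊎ φ d ≡ kk β zero) → Outcome
    upper β s s≢0 all = go (all a₀) (all b₀)
      where
      toMem : ∀ {x} → XMem x β s → Mem x β s
      toMem (inj₁ m)         = m
      toMem (inj₂ (s≡0 , _)) = contradiction s≡0 s≢0
      few : ∀ {a} → φ a ≡ kk β zero → ∀ {c} → adj H a c ≡ true → NotRemoved (just (a₀ , b₀)) a c → φ c ∈ ylist β s
      few {a} a≡ {c} ac keep = pick (φ c) refl (kk-nbr (subst (λ q → E R q (φ c)) a≡ (kept ac keep))) (all c)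
        where
        pick : ∀ q → φ c ≡ q → KNbr β q → XMem q β s ⊎ q ≡ kk β zero → q ∈ ylist β s
        pick q c≡ (nb-core ic) (inj₁ m)    = contradiction ic (XMem-¬core m)
        pick q c≡ (nb-core _)  (inj₂ q≡k)  = contradiction (φ-inj (trans a≡ (sym (trans c≡ q≡k)))) (adj-≢ ac)
        pick q c≡ (nb-y l<e) (inj₁ (inj₁ yy-mem)) = ∈-ylist l<e
        pick q c≡ (nb-y l<e) (inj₁ (inj₂ (s≡0 , _))) = contradiction s≡0 s≢0
        pick q c≡ nb-u (inj₁ m) with toMem m
        ... | ()
      go : XMem (φ a₀) β s ⊎ φ a₀ ≡ kk β zero → XMem (φ b₀) β s ⊎ φ b₀ ≡ kk β zero → Outcome
      go (inj₁ ma)  (inj₁ mb)  = inj₁ (static (block a₀≢b₀ (toMem ma) (toMem mb)))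
      go (inj₂ a≡k) _          = ⊥-elim (too-few β s (deg-partner fst (ylist β s) (few a≡k)))
      go (inj₁ _)   (inj₂ b≡k) = ⊥-elim (too-few β s (deg-partner snd (ylist β s) (few b≡k)))

    RowPt : Fin p → Fin h → Set
    RowPt β c = IsPt (φ c) × Σ (Fin n) λ w → φ c ≡ ρ β w

    row-nbr : ∀ β {w x y} → IsPt x → x ≡ ρ β w → E R x y → XMem y β zero ⊎ y ≡ kk β zero →
              Σ (Fin n) λ w′ → y ≡ ρ β w′
    row-nbr β {w} ip x≡ (row γ {w₁} {w₂} _ eq eq′) _ with ρ-injective β w γ w₁ (trans (sym x≡) eq)
    ... | refl , _ = w₂ , eq′
    row-nbr β ip x≡ (static s) (inj₁ (inj₂ (_ , w′ , y≡))) = w′ , y≡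
    row-nbr β {w} ip x≡ (static (block x≢y (pt-mem c i) (pt-mem c′ i′))) (inj₁ (inj₁ (pt-mem c₀ i₀)))
      = ⊥-elim (far (row-layer′ x≡) i i′ i₀)
      where
      row-layer′ : ∀ {x t} → pt x t ≡ ρ β w → toℕ t ≡ toℕ (place β w)
      row-layer′ eq with ρ β w | rowView β w
      row-layer′ refl | _ | at-pt _ _ = refl
      far : ∀ {x t β₁ s₁ y t′ c c′ c₀} → toℕ t ≡ toℕ (place β w) → Inc c x t β₁ s₁ → Inc c′ y t′ β₁ s₁ → ¬ Inc c₀ y t′ β zero
      far {t = t} {t′ = t′} {c₀ = c₀} t≡ i i′ (inc _ l) = contradiction
        (begin
          gap              ≤⟨ gap≤place β w ⟩
          toℕ (place β w)  ≡⟨ sym t≡ ⟩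
          toℕ t            ≤⟨ Inc-near i i′ ⟩
          suc (toℕ t′)     ≤⟨ s≤s (proj₁ (shift-≤ c₀ (toℕ t′))) ⟩
          suc (shift c₀ (toℕ t′)) ≡⟨ cong suc (sym l) ⟩
          1                ∎) λ { (s≤s ()) }
        where open ℕᵖ.≤-Reasoning
    row-nbr β {w} ip x≡ (static (block x≢y (pt-mem c i) yy-mem)) (inj₁ (inj₁ yy-mem)) = ⊥-elim (low x≡ i)
      where
      low : ∀ {x t} → pt x t ≡ ρ β w → ¬ Inc c x t β zero
      low eq i with ρ β w | rowView β w
      low refl i | _ | at-pt _ _ = row-not-first i
    row-nbr β {w} ip x≡ (static (block x≢y (pt-mem c i) vv-mem)) (inj₁ (inj₁ vv-mem)) = ⊥-elim (low x≡ i)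
      where
      low : ∀ {x t} → pt x t ≡ ρ β w → ¬ Inc c x t β zero
      low eq i with ρ β w | rowView β w
      low refl i | _ | at-pt _ _ = row-not-first i
    row-nbr β ip x≡ (static (block x≢y (pt-mem c i) ())) (inj₂ refl)
    row-nbr β () x≡ (static (block x≢y yy-mem _)) _
    row-nbr β () x≡ (static (block x≢y vv-mem _)) _
    row-nbr β () x≡ (static (core _)) _
    row-nbr β () x≡ (static (attach (k-y _))) _
    row-nbr β () x≡ (static (attach k-u)) _
    row-nbr β () x≡ (static (attach (u-y _))) _
    row-nbr β () x≡ (static (attach⁻ (k-y _))) _
    row-nbr β () x≡ (static (attach⁻ k-u)) _
    row-nbr β () x≡ (static (attach⁻ (u-y _))) _

    -- {u , v} separates the rest of the copy of G from the rest of the block.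
    lower-row : ∀ β → (∀ d → XMem (φ d) β zero ⊎ φ d ≡ kk β zero) → Σ (Fin h) (RowPt β) → Outcome
    lower-row β all (c , rp) = inj₂ (β , (λ d → proj₁ (inRow d)) , λ d → proj₂ (inRow d))
      where
      RowPt? : ∀ d → Dec (RowPt β d)
      RowPt? d = IsPt? (φ d) ×-dec any? λ w → φ d ≟ ρ β w
      isPt : ∀ {x w} → x ≡ ρ β w → x ≢ uu β → x ≢ vv β → IsPt x
      isPt {w = w} refl x≢u x≢v with ρ β w | rowView β w
      ... | _ | at-u _    = contradiction refl x≢u
      ... | _ | at-v _    = contradiction refl x≢v
      ... | _ | at-pt _ _ = tt
      pt-≢ : ∀ {x} → IsPt x → x ≢ uu β × x ≢ vv β
      pt-≢ {pt _ _} _ = (λ ()) , (λ ())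
      closed : ∀ {x y} → RowPt β x → adj H x y ≡ true → NotRemoved (just (a₀ , b₀)) x y →
               φ x ≢ uu β → φ y ≢ uu β → φ y ≢ vv β → RowPt β y
      closed {x} {y} (ip , w , x≡) xy keep _ y≢u y≢v =
        let w′ , y≡ = row-nbr β {w} ip x≡ (kept xy keep) (all y) in isPt {w = w′} y≡ y≢u y≢v , w′ , y≡
      inRow : ∀ d → Σ (Fin n) λ w → φ d ≡ ρ β w
      inRow d with φ d ≟ uu β | φ d ≟ vv β
      ... | yes d≡u | _       = u , trans d≡u (sym (ρ-u β))
      ... | no _    | yes d≡v = v , trans d≡v (sym (ρ-v β))
      ... | no d≢u  | no d≢v  = proj₂ (spread-off₂ H _≟_ φ-inj insep {a₀} {b₀} (uu β) (vv β) RowPt? closed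
                                  (proj₁ (pt-≢ (proj₁ rp))) (proj₂ (pt-≢ (proj₁ rp))) rp d≢u d≢v)

    -- Outside the clique only u and kk β zero remain; they are adjacent and have e + 1 neighbours each,
    -- so neither can be completed to a vertex of H by one further edge.
    lower-block : ∀ β → (∀ d → XMem (φ d) β zero ⊎ φ d ≡ kk β zero) → ¬ Σ (Fin h) (RowPt β) → Outcome
    lower-block β all noRow = go (kind a₀) (kind b₀)
      where
      data Kind (c : Fin h) : Set where
        mem : Mem (φ c) β zero → Kind c
        isU : φ c ≡ uu β → Kind c
        isK : φ c ≡ kk β zero → Kind c
      kind : ∀ c → Kind c
      kind c with all c
      ... | inj₂ c≡k = isK c≡k
      ... | inj₁ (inj₁ m) = mem m
      ... | inj₁ (inj₂ (_ , w , c≡)) = aux (ρ β w) (rowView β w) c≡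
        where
        aux : ∀ x → RowView β w x → φ c ≡ x → Kind c
        aux _ (at-u _) eq    = isU eq
        aux _ (at-v _) eq    = mem (subst (λ q → Mem q β zero) (sym eq) vv-mem)
        aux _ (at-pt _ _) eq = contradiction (c , subst IsPt (sym eq) tt , w , c≡) noRow
      K U : Vertex
      K = kk β zero
      U = uu β
      ys = ylist β zero
      K-few : ∀ {a} → φ a ≡ K → ∀ {c} → adj H a c ≡ true → NotRemoved (just (a₀ , b₀)) a c → φ c ∈ U ∷ ys
      K-few {a} a≡ {c} ac keep = pick (φ c) refl (kk-nbr (subst (λ q → E R q (φ c)) a≡ (kept ac keep))) (all c)
        where
        pick : ∀ q → φ c ≡ q → KNbr β q → XMem q β zero ⊎ q ≡ K → q ∈ U ∷ ys
        pick q c≡ (nb-core ic) (inj₁ m)    = contradiction ic (XMem-¬core m)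
        pick q c≡ (nb-core _)  (inj₂ q≡k)  = contradiction (φ-inj (trans a≡ (sym (trans c≡ q≡k)))) (adj-≢ ac)
        pick q c≡ (nb-y l<e) (inj₁ m) with home-XMem (λ ()) m
        ... | refl = there (∈-ylist l<e)
        pick q c≡ nb-u _ = here refl
      U-few : ∀ {a} → φ a ≡ U → ∀ {c} → adj H a c ≡ true → NotRemoved (just (a₀ , b₀)) a c → φ c ∈ K ∷ ys
      U-few {a} a≡ {c} ac keep = pick (φ c) refl (uu-nbr (subst (λ q → E R q (φ c)) a≡ (kept ac keep)))
        where
        pick : ∀ q → φ c ≡ q → UNbr R β q → q ∈ K ∷ ys
        pick q c≡ nb-k     = here refl
        pick q c≡ (nb-y l<e) = there (∈-ylist l<e)
        pick q c≡ (nb-row {w} Ruw) = ⊥-elim (aux (ρ β w) (rowView β w) c≡)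
          where
          aux : ∀ x → RowView β w x → φ c ≡ x → ⊥
          aux _ (at-u _) eq      = adj-≢ ac (φ-inj (trans a≡ (sym eq)))
          aux _ (at-v refl) eq   = ¬Ruv Ruw
          aux _ (at-pt _ _) eq   = noRow (c , subst IsPt (sym eq) tt , w , c≡)
      drop-head : ∀ {x q : Vertex} {L} → q ∈ x ∷ L → q ≢ x → q ∈ L
      drop-head (here q≡x) q≢x = contradiction q≡x q≢x
      drop-head (there q∈) _   = q∈
      mem-≢ : ∀ {c} → Mem (φ c) β zero → φ c ≢ K × φ c ≢ U
      mem-≢ m = (λ eq → no-k (subst (λ q → Mem q β zero) eq m)) , (λ eq → no-u (subst (λ q → Mem q β zero) eq m))
        where
        no-k : ¬ Mem K β zero
        no-k ()
        no-u : ¬ Mem U β zero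
        no-u ()
      apart : ∀ {a b c x y} → Partner a b → φ a ≡ x → Mem (φ b) β zero → φ c ≡ y → x ≢ y → (y ≡ K ⊎ y ≡ U) → c ≢ a₀ × c ≢ b₀
      apart pr a≡ mb c≡ x≢y y∈ = split pr
        (λ c≡a → x≢y (trans (sym a≡) (trans (cong φ (sym c≡a)) c≡)))
        (λ c≡b → off y∈ (trans (cong φ (sym c≡b)) c≡))
        where
        off : ∀ {y} → (y ≡ K ⊎ y ≡ U) → φ _ ≢ y
        off (inj₁ refl) = proj₁ (mem-≢ mb)
        off (inj₂ refl) = proj₂ (mem-≢ mb)
        split : ∀ {a b c} → Partner a b → c ≢ a → c ≢ b → c ≢ a₀ × c ≢ b₀
        split fst c≢a c≢b = c≢a , c≢b
        split snd c≢a c≢b = c≢b , c≢a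
      U-mem : ∀ {a b} → Partner a b → φ a ≡ U → Mem (φ b) β zero → ⊥
      U-mem pr a≡ mb with any? (λ c → φ c ≟ K)
      ... | yes (c , c≡K) = let c≢a₀ , c≢b₀ = apart pr a≡ mb c≡K (λ ()) (inj₁ refl) in
        too-few β zero (deg-other c≢a₀ c≢b₀ (U ∷ ys) (K-few c≡K))
      ... | no noK = too-few β zero (deg-partner pr ys λ {c} ac keep →
        drop-head (U-few a≡ ac keep) λ c≡K → noK (c , c≡K))
      K-mem : ∀ {a b} → Partner a b → φ a ≡ K → Mem (φ b) β zero → ⊥
      K-mem pr a≡ mb with any? (λ c → φ c ≟ U)
      ... | yes (c , c≡U) = let c≢a₀ , c≢b₀ = apart pr a≡ mb c≡U (λ ()) (inj₂ refl) in
        too-few β zero (deg-other c≢a₀ c≢b₀ (K ∷ ys) (U-few c≡U))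
      ... | no noU = too-few β zero (deg-partner pr ys λ {c} ac keep →
        drop-head (K-few a≡ ac keep) λ c≡U → noU (c , c≡U))
      go : Kind a₀ → Kind b₀ → Outcome
      go (mem ma) (mem mb) = inj₁ (static (block a₀≢b₀ ma mb))
      go (mem ma) (isU bU) = ⊥-elim (U-mem snd bU ma)
      go (mem ma) (isK bK) = ⊥-elim (K-mem snd bK ma)
      go (isU aU) (mem mb) = ⊥-elim (U-mem fst aU mb)
      go (isK aK) (mem mb) = ⊥-elim (K-mem fst aK mb)
      go (isU aU) (isU bU) = contradiction (trans aU (sym bU)) a₀≢b₀
      go (isK aK) (isK bK) = contradiction (trans aK (sym bK)) a₀≢b₀
      go (isU aU) (isK bK) = inj₁ (subst₂ (E R) (sym aU) (sym bK) (static (attach⁻ k-u)))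
      go (isK aK) (isU bU) = inj₁ (subst₂ (E R) (sym aK) (sym bU) (static (attach k-u)))

    confinement : Outcome
    confinement with any? (λ c → ¬? (IsCore? (φ c)))
    ... | no allCore = inj₁ (static (core′ (coreAt a₀) (coreAt b₀) a₀≢b₀))
      where
      coreAt : ∀ c → IsCore (φ c)
      coreAt c = decidable-stable (IsCore? (φ c)) λ ¬c → allCore (c , ¬c)
    ... | yes (c , ¬core) with findLeaf φ φ-inj c ¬core
    ... | β , s , z , z∈ , leaf , c₁ , m , c₁≢z with confined β s z z∈ leaf c₁ m c₁≢z | s Finᵖ.≟ zero
    ... | all | no s≢0 = upper β s s≢0 all
    ... | all | yes refl with any? (λ d → IsPt? (φ d) ×-dec any? λ w → φ d ≟ ρ β w)
    ... | yes rp = lower-row β all rp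
    ... | no ¬rp = lower-block β all ¬rp

-- Percolation

module Percolation {h : ℕ} (H : Graph h) {e : ℕ} {root : Fin h} (deg-root : deg H root ≡ 2 + e)
  {n : ℕ} (Φ : FreeInvolutions (2 + e) (2 + (h + h))) (u v : Fin n) (u≢v : u ≢ v) where

  open Construction h e n Φ u v u≢v

  σ-distinct : ∀ {x i j} → σ i x ≡ σ j x → i ≡ j
  σ-distinct {x} {i} {j} eq with i Finᵖ.≟ j
  ... | yes i≡j = i≡j
  ... | no i≢j  = contradiction (trans (cong (σ j) eq) (invol j x)) (free i (j ∷ []) (i≢j ∷ [-]) (s≤s (s≤s z≤n)) x)

  module _ {F : Vertex → Vertex → Set} (closed : Closed H F) (F-sym : ∀ {x y} → F x y → F y x)
    (static⇒F : ∀ {x y} → Static x y → F x y) (F-uv : ∀ γ → F (uu γ) (vv γ))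
    (rowNbrs : ∀ {w} → w ≡ u ⊎ w ≡ v → Σ (List (Fin n)) λ ws → Unique ws × length ws ≡ suc e ×
      (∀ {w′} → w′ ∈ ws → w′ ≢ u × w′ ≢ v × (∀ γ → F (ρ γ w) (ρ γ w′)))) where

    join : ∀ {Q : Vertex → Set} → Clique H F Q → ∀ {z} g → Unique g → length g ≡ suc e →
           (∀ {q} → q ∈ g → Q q × q ≢ z × F z q) →
           (sup : Fin fill → Vertex) → (∀ {i j} → sup i ≡ sup j → i ≡ j) → (∀ i → Q (sup i)) →
           ∀ {y} → Q y → y ≢ z → F z y
    join {Q} cliq g g! ∣g∣ g-ok sup sup-inj sup-ok =
      absorb H _≟_ closed F-sym deg-root cliq g g! (ℕᵖ.≤-reflexive (sym ∣g∣)) g-ok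
        (tabulate sup) (Uniqueᵖ.tabulate⁺ sup-inj)
        (λ q∈ → let i , q≡ = ∈-tabulate⁻ {f = sup} q∈ in subst Q (sym q≡) (sup-ok i))
        (ℕᵖ.≤-reflexive (trans (cong (λ l → h + (2 + l)) ∣g∣) (sym (length-tabulate sup))))

    Abs : Vertex → Set
    Abs x = ∀ {y} → IsCore y → y ≢ x → F x y

    core-clique : Clique H F IsCore
    core-clique cx cy x≢y = static⇒F (core′ cx cy x≢y)

    core-Abs : ∀ {x} → IsCore x → Abs x
    core-Abs cx cy y≢x = core-clique cx cy (y≢x ∘ sym)

    spare : Fin fill → Vertex
    spare i = kk base (suc i)

    spare-injective : ∀ {i j} → spare i ≡ spare j → i ≡ j
    spare-injective refl = refl

    1+e≤fill : suc e ≤ fill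
    1+e≤fill = ℕᵖ.≤-trans (ℕᵖ.m≤n+m (suc e) 2) (ℕᵖ.m≤n+m (3 + e) h)

    Abs-clique : Clique H F Abs
    Abs-clique {x} {y} ax ay x≢y with IsCore? x | IsCore? y
    ... | _      | yes cy = ax cy (x≢y ∘ sym)
    ... | yes cx | no _   = F-sym (ay cx x≢y)
    ... | no ¬cx | no ¬cy = F-sym (join cliq g (Uniqueᵖ.tabulate⁺ g-inj) (length-tabulate f) g-ok
                              spare spare-injective (λ _ → inj₁ tt) (inj₂ refl) x≢y)
      where
      Q : Vertex → Set
      Q q = IsCore q ⊎ q ≡ x
      cliq : Clique H F Q
      cliq (inj₁ c)    (inj₁ c′)   q≢ = core-clique c c′ q≢
      cliq (inj₁ c)    (inj₂ refl) q≢ = F-sym (ax c q≢)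
      cliq (inj₂ refl) (inj₁ c)    q≢ = ax c (q≢ ∘ sym)
      cliq (inj₂ refl) (inj₂ refl) q≢ = contradiction refl q≢
      f : Fin (suc e) → Vertex
      f i = spare (inject≤ i 1+e≤fill)
      g-inj : ∀ {i j} → f i ≡ f j → i ≡ j
      g-inj eq = Finᵖ.inject≤-injective _ _ _ _ (spare-injective eq)
      g : List Vertex
      g = tabulate f
      g-ok : ∀ {q} → q ∈ g → Q q × q ≢ y × F y q
      g-ok q∈ with ∈-tabulate⁻ {f = f} q∈
      ... | i , refl = inj₁ tt , fi≢y i , ay tt (fi≢y i)
        where
        fi≢y : ∀ i → f i ≢ y
        fi≢y i eq = ¬cy (subst IsCore eq tt)

    absorbed : ∀ {z} g → Unique g → length g ≡ suc e → (∀ {q} → q ∈ g → Abs q × q ≢ z × F z q) → Abs z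
    absorbed g g! ∣g∣ g-ok cy y≢z =
      join Abs-clique g g! ∣g∣ g-ok spare spare-injective (λ _ → core-Abs tt) (core-Abs cy) y≢z

    pendant : Fin p → Fin layers → Fin e → Vertex
    pendant β s i = yy β s (inject≤ i e≤fill)

    pendant-< : (i : Fin e) → toℕ (inject≤ i e≤fill) < e
    pendant-< i = subst (_< e) (sym (Finᵖ.toℕ-inject≤ i e≤fill)) (Finᵖ.toℕ<n i)

    yy-injective : ∀ {β s l l′} → yy β s l ≡ yy β s l′ → l ≡ l′
    yy-injective refl = refl

    attach-join : ∀ β s {Q : Vertex → Set} → Clique H F Q → (∀ l → Q (yy β s l)) → ∀ {z q} → Q q → F z q → q ≢ z →
                  (∀ l → yy β s l ≢ z) → (∀ l → q ≢ yy β s l) → (∀ {l} → toℕ l < e → F z (yy β s l)) → ∀ {y} → Q y → y ≢ z → F z y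
    attach-join β s {Q} cliq ys⊆Q {z} {q} Qq Fzq q≢z y≢z q≢y Fzy = join cliq (q ∷ tabulate (pendant β s))
      (All.tabulate (λ x∈ q≡x → let i , x≡ = ∈-tabulate⁻ {f = pendant β s} x∈ in q≢y _ (trans q≡x x≡))
        ∷ Uniqueᵖ.tabulate⁺ (λ eq → Finᵖ.inject≤-injective _ _ _ _ (yy-injective eq)))
      (cong suc (length-tabulate (pendant β s))) ok (yy β s) yy-injective ys⊆Q
      where
      ok : ∀ {x} → x ∈ q ∷ tabulate (pendant β s) → Q x × x ≢ z × F z x
      ok (here refl) = Qq , q≢z , Fzq
      ok (there x∈) with ∈-tabulate⁻ {f = pendant β s} x∈
      ... | i , refl = ys⊆Q _ , y≢z _ , Fzy (pendant-< i)

    block-clique : ∀ β s → Clique H F (λ x → Mem x β s)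
    block-clique β s mx my x≢y = static⇒F (block x≢y mx my)

    u-joins : ∀ γ {y} → Mem y γ zero → F (uu γ) y
    u-joins γ m = attach-join γ zero (block-clique γ zero) (λ _ → yy-mem) vv-mem (F-uv γ) (λ ()) (λ _ ()) (λ _ ())
      (λ l<e → static⇒F (attach (u-y l<e))) m (Mem-≢u m)
      where
      Mem-≢u : ∀ {y} → Mem y γ zero → y ≢ uu γ
      Mem-≢u () refl

    Fired : Fin layers → Set
    Fired s = ∀ β {y} → Mem y β s → F (kk β zero) y

    Mem-≢k : ∀ {y β s γ i} → Mem y β s → y ≢ kk γ i
    Mem-≢k () refl

    fired-first : Fired zero
    fired-first γ m = attach-join γ zero cliq (λ _ → inj₁ yy-mem) (inj₂ refl) (static⇒F (attach k-u)) (λ ()) (λ _ ()) (λ _ ())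
      (λ l<e → static⇒F (attach (k-y l<e))) (inj₁ m) (Mem-≢k m)
      where
      cliq : Clique H F (λ x → Mem x γ zero ⊎ x ≡ uu γ)
      cliq (inj₁ mx)   (inj₁ my)   x≢y = block-clique γ zero mx my x≢y
      cliq (inj₁ mx)   (inj₂ refl) x≢y = F-sym (u-joins γ mx)
      cliq (inj₂ refl) (inj₁ my)   x≢y = u-joins γ my
      cliq (inj₂ refl) (inj₂ refl) x≢y = contradiction refl x≢y

    fired-next : ∀ {s t} → toℕ s ≡ suc (toℕ t) → (∀ x → Abs (pt x t)) → Fired s
    fired-next {s} {t} s≡ abs β m = attach-join β s (block-clique β s) (λ _ → yy-mem)
      (pt-mem zero {t = t} (inc refl s≡)) (F-sym (abs (σ zero β) tt (λ ()))) (λ ()) (λ _ ()) (λ _ ())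
      (λ l<e → static⇒F (attach (k-y l<e))) m (Mem-≢k m)

    fired⇒Abs : ∀ {s} → Fired s → ∀ x → Abs (pt x s)
    fired⇒Abs {s} fired x = absorbed (tabulate f) (Uniqueᵖ.tabulate⁺ f-inj) (length-tabulate f) ok
      where
      f : Fin (suc e) → Vertex
      f j = kk (σ (suc j) x) zero
      f-inj : ∀ {i j} → f i ≡ f j → i ≡ j
      f-inj eq = Finᵖ.suc-injective (σ-distinct (kk-inj eq))
        where
        kk-inj : ∀ {a b i j} → kk a i ≡ kk b j → a ≡ b
        kk-inj refl = refl
      ok : ∀ {q} → q ∈ tabulate f → Abs q × q ≢ pt x s × F (pt x s) q
      ok q∈ with ∈-tabulate⁻ {f = f} q∈
      ... | j , refl = core-Abs tt , (λ ()) ,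
        F-sym (fired (σ (suc j) x) (pt-mem (suc j) (inc (sym (invol (suc j) x)) refl)))

    pt-Abs : ∀ k t → toℕ t ≡ k → ∀ x → Abs (pt x t)
    pt-Abs zero    zero    _  = fired⇒Abs fired-first
    pt-Abs (suc k) (suc t) eq = fired⇒Abs (fired-next {t = t′} s≡ (pt-Abs k t′ t′≡))
      where
      t′ : Fin layers
      t′ = inject₁ t
      s≡ : suc (toℕ t) ≡ suc (toℕ t′)
      s≡ = cong suc (sym (Finᵖ.toℕ-inject₁ t))
      t′≡ : toℕ t′ ≡ k
      t′≡ = ℕᵖ.suc-injective (trans (sym s≡) eq)

    ρ-Abs : ∀ γ w → w ≢ u → w ≢ v → Abs (ρ γ w)
    ρ-Abs γ w w≢u w≢v with ρ γ w | rowView γ w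
    ... | _ | at-u w≡u  = contradiction w≡u w≢u
    ... | _ | at-v w≡v  = contradiction w≡v w≢v
    ... | _ | at-pt _ _ = pt-Abs _ _ refl γ

    end-Abs : ∀ γ {w} → w ≡ u ⊎ w ≡ v → Abs (ρ γ w)
    end-Abs γ {w} end with rowNbrs end
    ... | ws , ws! , ∣ws∣ , ok = absorbed (map (ρ γ) ws)
      (Uniqueᵖ.map⁺ (λ {a} {b} eq → proj₂ (ρ-injective γ a γ b eq)) ws!) (trans (length-map (ρ γ) ws) ∣ws∣) ok′
      where
      ok′ : ∀ {q} → q ∈ map (ρ γ) ws → Abs q × q ≢ ρ γ w × F (ρ γ w) q
      ok′ q∈ with ∈-map⁻ (ρ γ) q∈
      ... | w′ , w′∈ , refl = let w′≢u , w′≢v , Fww′ = ok w′∈ in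
        ρ-Abs γ w′ w′≢u w′≢v , (λ eq → off end w′≢u w′≢v (proj₂ (ρ-injective γ w′ γ w eq))) , Fww′ γ
        where
        off : ∀ {w w′} → w ≡ u ⊎ w ≡ v → w′ ≢ u → w′ ≢ v → w′ ≢ w
        off (inj₁ refl) w′≢u _ = w′≢u
        off (inj₂ refl) _ w′≢v = w′≢v

    all-Abs : ∀ x → Abs x
    all-Abs (kk _ _)   = core-Abs tt
    all-Abs (pt x t)   = pt-Abs _ t refl x
    all-Abs (uu γ)     = subst Abs (ρ-u γ) (end-Abs γ (inj₁ refl))
    all-Abs (vv γ)     = subst Abs (ρ-v γ) (end-Abs γ (inj₂ refl))
    all-Abs (yy β s l) = absorbed (tabulate f) (Uniqueᵖ.tabulate⁺ f-inj) (length-tabulate f) ok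
      where
      f : Fin (suc e) → Vertex
      f j = pt (σ (suc j) β) s
      f-inj : ∀ {i j} → f i ≡ f j → i ≡ j
      f-inj eq = Finᵖ.suc-injective (σ-distinct (pt-inj eq))
        where
        pt-inj : ∀ {a b i j} → pt a i ≡ pt b j → a ≡ b
        pt-inj refl = refl
      ok : ∀ {q} → q ∈ tabulate f → Abs q × q ≢ yy β s l × F (yy β s l) q
      ok q∈ with ∈-tabulate⁻ {f = f} q∈
      ... | j , refl = pt-Abs _ s refl _ , (λ ()) , static⇒F (block (λ ()) yy-mem (pt-mem (suc j) (inc refl refl)))

    complete : ∀ {x y} → x ≢ y → F x y
    complete = Abs-clique (all-Abs _) (all-Abs _)

-- The process on the constructed graph

does⇒ : ∀ {P : Set} (P? : Dec P) → does P? ≡ true → P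
does⇒ (yes p) _ = p

⇒does : ∀ {P : Set} (P? : Dec P) → P → does P? ≡ true
⇒does (yes _) _ = refl
⇒does (no ¬p) p = contradiction p ¬p

does-cong : ∀ {P Q : Set} (P? : Dec P) (Q? : Dec Q) → (P → Q) → (Q → P) → does P? ≡ does Q?
does-cong (yes _) (yes _) _ _ = refl
does-cong (no _)  (no _)  _ _ = refl
does-cong (yes p) (no ¬q) f _ = contradiction (f p) ¬q
does-cong (no ¬p) (yes q) _ g = contradiction (g q) ¬p

stable-absorbs : ∀ {h m} (H : Graph h) (G : Graph m) t → Stable H G t →
                 ∀ s {u v} → process H G s u v → process H G t u v
stable-absorbs H G t st zero    uv        = process-≤ H G {t = t} z≤n uv
stable-absorbs H G t st (suc s) (inj₁ uv) = stable-absorbs H G t st s uv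
stable-absorbs H G t st (suc s) (inj₂ uv) =
  st _ _ (inj₂ (CopyThrough-mono H (process H G s) (process H G t) (stable-absorbs H G t st s) uv))

copy-nbrs : ∀ {h} (H : Graph h) {e} → (∀ a → 2 + e ≤ deg H a) →
  ∀ {n} (R : Rel n) {x y} → x ≢ y → CopyThrough H R x y →
  Σ (List (Fin n)) λ ws → Unique ws × length ws ≡ suc e × (∀ {w} → w ∈ ws → w ≢ x × w ≢ y × R x w)
copy-nbrs {h} H {e} e≤deg R {x} {y} x≢y (φ , inj , edge , a , b , ab , a↦x , b↦y) =
  map φ cs , Uniqueᵖ.map⁺ (inj _ _) (Uniqueᵖ.take⁺ (suc e) (Uniqueᵖ.filter⁺ (λ c → ¬? (c Finᵖ.≟ b)) (nbrs-unique H a))) ,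
  trans (length-map φ cs) (trans (length-take (suc e) others) (ℕᵖ.m≤n⇒m⊓n≡m enough)) , ok
  where
  others cs : List (Fin h)
  others = filter (λ c → ¬? (c Finᵖ.≟ b)) (nbrs H a)
  cs     = take (suc e) others
  enough : suc e ≤ length others
  enough = ℕᵖ.≤-pred (ℕᵖ.≤-trans (e≤deg a) (Unique-⊆⇒length≤ {L = b ∷ others} (nbrs-unique H a) split))
    where
    split : ∀ {c} → c ∈ nbrs H a → c ∈ b ∷ others
    split {c} c∈ with c Finᵖ.≟ b
    ... | yes refl = here refl
    ... | no c≢b   = there (∈-filter⁺ (λ c → ¬? (c Finᵖ.≟ b)) c∈ c≢b)
  cs-ok : All (λ c → c ∈ nbrs H a × c ≢ b) cs
  cs-ok = Allᵖ.take⁺ (suc e) (All.tabulate (∈-filter⁻ (λ c → ¬? (c Finᵖ.≟ b)) {xs = nbrs H a}))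
  ok : ∀ {w} → w ∈ map φ cs → w ≢ x × w ≢ y × R x w
  ok w∈ with ∈-map⁻ φ w∈
  ... | c , c∈ , refl with All.lookup cs-ok c∈
  ... | c∈ns , c≢b = c≢x , c≢y , edge′ (edge a c (∈-nbrs⁻ H c∈ns))
    where
    c≢x : φ c ≢ x
    c≢x eq with refl ← inj c a (trans eq (sym a↦x)) = irrefl H a (∈-nbrs⁻ H c∈ns)
    c≢y : φ c ≢ y
    c≢y eq = c≢b (inj c b (trans eq (sym b↦y)))
    edge′ : addEdge R x y (φ a) (φ c) → R x (φ c)
    edge′ (inj₁ r)                = subst (λ z → R z (φ c)) a↦x r
    edge′ (inj₂ (inj₁ (_ , c≡y))) = contradiction c≡y c≢y
    edge′ (inj₂ (inj₂ (a≡y , _))) = contradiction (trans (sym a↦x) a≡y) x≢y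

module Extremal {h : ℕ} (H : Graph h) (insep : ¬ Separable21 H) {e : ℕ} {root : Fin h} (deg-root : deg H root ≡ 2 + e)
  (e≤deg : ∀ a → 2 + e ≤ deg H a) (Φ : FreeInvolutions (2 + e) (2 + (h + h)))
  {n : ℕ} (G : Graph n) {M : ℕ} (rt : RunningTime H G (suc M)) {u v : Fin n} (u≢v : u ≢ v)
  (uv-last : CopyThrough H (process H G M) u v) (uv-new : ¬ process H G M u v) where

  open Construction h e n Φ u v u≢v
  open Confinement H insep e≤deg Φ u v u≢v using (confinement)
  open Percolation H deg-root Φ u v u≢v using (complete)

  R : ℕ → Rel n
  R = process H G

  E₀? : ∀ x y → Dec (E (R 0) x y)
  E₀? = E? (λ w w′ → adj G w w′ Boolᵖ.≟ true)

  G̃ : Graph order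
  G̃ = record
    { adj    = λ x y → does (E₀? (dec x) (dec y))
    ; sym    = λ x y → does-cong (E₀? (dec x) (dec y)) (E₀? (dec y) (dec x)) E₀-sym E₀-sym
    ; irrefl = λ x p → E-irrefl {R 0} (process-irrefl H G 0) (does⇒ (E₀? (dec x) (dec x)) p)
    }
    where
    E₀-sym : ∀ {x y} → E (R 0) x y → E (R 0) y x
    E₀-sym = E-sym {R 0} (process-sym H G 0)

  start : ∀ {x y} → E (R 0) x y → adj G̃ (enc x) (enc y) ≡ true
  start {x} {y} xy = ⇒does (E₀? (dec (enc x)) (dec (enc y)))
    (subst₂ (E (R 0)) (sym (dec-enc x)) (sym (dec-enc y)) xy)

  E-mono : ∀ s {x y} → E (R s) x y → E (R (suc s)) x y
  E-mono s (static st)        = static st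
  E-mono s (row γ r x≡ y≡)    = row γ (inj₁ r) x≡ y≡

  dec-injective : ∀ {x y} → dec x ≡ dec y → x ≡ y
  dec-injective {x} {y} eq = trans (sym (enc-dec x)) (trans (cong enc eq) (enc-dec y))

  enc-injective : ∀ {x y} → enc x ≡ enc y → x ≡ y
  enc-injective {x} {y} eq = trans (sym (dec-enc x)) (trans (cong dec eq) (dec-enc y))

  upper-bound : ∀ s → s ≤ M → ∀ {x y} → process H G̃ s x y → E (R s) (dec x) (dec y)
  upper-bound zero    _   {x} {y} xy = does⇒ (E₀? (dec x) (dec y)) xy
  upper-bound (suc s) s<M (inj₁ xy) = E-mono s (upper-bound s (ℕᵖ.<⇒≤ s<M) xy)
  upper-bound (suc s) s<M {x} {y} (inj₂ (φ , inj , edge , a , b , ab , a↦x , b↦y)) =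
    subst₂ (E (R (suc s))) (cong dec a↦x) (cong dec b↦y)
      (result (confinement {R s} (uv-new ∘ process-≤ H G (ℕᵖ.<⇒≤ s<M)) (λ {c} {d} → inj c d ∘ dec-injective) ab kept))
    where
    IH : ∀ {x y} → process H G̃ s x y → E (R s) (dec x) (dec y)
    IH = upper-bound s (ℕᵖ.<⇒≤ s<M)
    kept : ∀ {c d} → adj H c d ≡ true → NotRemoved (just (a , b)) c d → E (R s) (dec (φ c)) (dec (φ d))
    kept {c} {d} cd keep with edge c d cd
    ... | inj₁ p = IH p
    ... | inj₂ (inj₁ (c↦x , d↦y)) = contradiction (inj₁ (inj c a (trans c↦x (sym a↦x)) , inj d b (trans d↦y (sym b↦y)))) keep
    ... | inj₂ (inj₂ (c↦y , d↦x)) = contradiction (inj₂ (inj c b (trans c↦y (sym b↦y)) , inj d a (trans d↦x (sym a↦x)))) keep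
    result : E (R s) (dec (φ a)) (dec (φ b)) ⊎ (Σ (Fin p) λ γ → Σ (Fin h → Fin n) λ ψ → ∀ c → dec (φ c) ≡ ρ γ (ψ c)) →
             E (R (suc s)) (dec (φ a)) (dec (φ b))
    result (inj₁ E-ab) = E-mono s E-ab
    result (inj₂ (γ , ψ , eq)) = row γ (inj₂ (ψ , ψ-inj , ψ-edge , a , b , ab , refl , refl)) (eq a) (eq b)
      where
      ψ-inj : Injective ψ
      ψ-inj c d ψc≡ψd = inj c d (dec-injective (trans (eq c) (trans (cong (ρ γ) ψc≡ψd) (sym (eq d)))))
      ψ-edge : ∀ c d → adj H c d ≡ true → addEdge (R s) (ψ a) (ψ b) (ψ c) (ψ d)
      ψ-edge c d cd with edge c d cd
      ... | inj₁ p = inj₁ (E-row {R s} {γ} {ψ c} {ψ d} (subst₂ (E (R s)) (eq c) (eq d) (IH p)))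
      ... | inj₂ (inj₁ (c↦x , d↦y)) =
        inj₂ (inj₁ (cong ψ (inj c a (trans c↦x (sym a↦x))) , cong ψ (inj d b (trans d↦y (sym b↦y)))))
      ... | inj₂ (inj₂ (c↦y , d↦x)) =
        inj₂ (inj₂ (cong ψ (inj c b (trans c↦y (sym b↦y))) , cong ψ (inj d a (trans d↦x (sym a↦x)))))

  row-in : ∀ γ → Fin n → Fin order
  row-in γ w = enc (ρ γ w)

  lower-bound : ∀ γ s {w w′} → R s w w′ → process H G̃ s (row-in γ w) (row-in γ w′)
  lower-bound γ zero    ww′        = start (row γ ww′ refl refl)
  lower-bound γ (suc s) (inj₁ ww′) = inj₁ (lower-bound γ s ww′)
  lower-bound γ (suc s) (inj₂ (φ , inj , edge , a , b , ab , a↦ , b↦)) = inj₂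
    ( row-in γ ∘ φ
    , (λ c d eq → inj c d (proj₂ (ρ-injective γ (φ c) γ (φ d) (enc-injective eq))))
    , (λ c d cd → lift (edge c d cd))
    , a , b , ab , cong (row-in γ) a↦ , cong (row-in γ) b↦ )
    where
    lift : ∀ {x y w w′} → addEdge (R s) w w′ x y → addEdge (process H G̃ s) (row-in γ w) (row-in γ w′) (row-in γ x) (row-in γ y)
    lift (inj₁ r)                     = inj₁ (lower-bound γ s r)
    lift (inj₂ (inj₁ (refl , refl)))  = inj₂ (inj₁ (refl , refl))
    lift (inj₂ (inj₂ (refl , refl)))  = inj₂ (inj₂ (refl , refl))

  unstable : ∀ s → s < suc M → ¬ Stable H G̃ s
  unstable s (s≤s s≤M) st = proj₂ rt s (s≤s s≤M) λ w w′ ww′ → E-row {R s} {base} {w} {w′}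
    (subst₂ (E (R s)) (dec-enc (ρ base w)) (dec-enc (ρ base w′))
      (upper-bound s s≤M (st _ _ (lower-bound base (suc s) ww′))))

  percolating : Percolating H G̃
  percolating t (st , _) x y x≢y = subst₂ (process H G̃ t) (enc-dec x) (enc-dec y)
    (complete {F} closed (process-sym H G̃ t) (λ s → process-≤ H G̃ {t = t} z≤n (start (static s))) F-uv rowNbrs
      (x≢y ∘ dec-injective))
    where
    F : Vertex → Vertex → Set
    F x y = process H G̃ t (enc x) (enc y)
    closed : Closed H F
    closed φ φ-inj {a} {b} ab kept = st _ _ (inj₂
      (enc ∘ φ , (λ c d eq → φ-inj (enc-injective eq)) , edge , a , b , ab , refl , refl))
      where
      edge : ∀ c d → adj H c d ≡ true → addEdge (process H G̃ t) (enc (φ a)) (enc (φ b)) (enc (φ c)) (enc (φ d))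
      edge c d cd with c Finᵖ.≟ a | d Finᵖ.≟ b | c Finᵖ.≟ b | d Finᵖ.≟ a
      ... | yes refl | yes refl | _        | _        = inj₂ (inj₁ (refl , refl))
      ... | _        | _        | yes refl | yes refl = inj₂ (inj₂ (refl , refl))
      ... | no c≢a   | _        | no c≢b   | _        = inj₁ (kept cd λ { (inj₁ (q , _)) → c≢a q ; (inj₂ (q , _)) → c≢b q })
      ... | no c≢a   | _        | _        | no d≢a   = inj₁ (kept cd λ { (inj₁ (q , _)) → c≢a q ; (inj₂ (_ , q)) → d≢a q })
      ... | _        | no d≢b   | no c≢b   | _        = inj₁ (kept cd λ { (inj₁ (_ , q)) → d≢b q ; (inj₂ (q , _)) → c≢b q })
      ... | _        | no d≢b   | _        | no d≢a   = inj₁ (kept cd λ { (inj₁ (_ , q)) → d≢b q ; (inj₂ (_ , q)) → d≢a q })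
    F-row : ∀ γ s {w w′} → R s w w′ → F (ρ γ w) (ρ γ w′)
    F-row γ s ww′ = stable-absorbs H G̃ t st s (lower-bound γ s ww′)
    F-uv : ∀ γ → F (uu γ) (vv γ)
    F-uv γ = subst₂ F (ρ-u γ) (ρ-v γ) (F-row γ (suc M) (inj₂ uv-last))
    rowNbrs : ∀ {w} → w ≡ u ⊎ w ≡ v → Σ (List (Fin n)) λ ws → Unique ws × length ws ≡ suc e ×
      (∀ {w′} → w′ ∈ ws → w′ ≢ u × w′ ≢ v × (∀ γ → F (ρ γ w) (ρ γ w′)))
    rowNbrs (inj₁ refl) with copy-nbrs H e≤deg (R M) u≢v uv-last
    ... | ws , ws! , ∣ws∣ , ok = ws , ws! , ∣ws∣ , λ w∈ → let w≢u , w≢v , r = ok w∈ in w≢u , w≢v , λ γ → F-row γ M r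
    rowNbrs (inj₂ refl) with copy-nbrs H e≤deg (R M) (u≢v ∘ sym) (CopyThrough-sym H (R M) uv-last)
    ... | ws , ws! , ∣ws∣ , ok = ws , ws! , ∣ws∣ , λ w∈ → let w≢v , w≢u , r = ok w∈ in w≢u , w≢v , λ γ → F-row γ M r

  slow : Σ ℕ λ t → RunningTime H G̃ t × suc M ≤ t
  slow = let t , rt̃ = runningTime H G̃ in t , rt̃ , ℕᵖ.≮⇒≥ λ t<M → unstable t t<M (proj₁ rt̃)

theorem4p2 : ∀ {h} (H : Graph h) → HasEdge H → ¬ Separable21 H →
    Σ ℕ λ C → ∀ (n : ℕ) →
    Σ ℕ λ m → Σ (Graph m) λ G̃ →
    m ≤ C * n
    × Percolating H G̃
    × (Σ ℕ λ t → RunningTime H G̃ t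
    × (∀ (G : Graph n) (s : ℕ) → RunningTime H G s → s ≤ t))
theorem4p2 {h} H edge insep with minDegree H edge insep
... | e , (root , deg-root) , e≤deg = C , λ n → build n (maxRunningTime H n)
  where
  Φ : FreeInvolutions (2 + e) (2 + (h + h))
  Φ = freeInvolutions (2 + e) (2 + (h + h))
  p = FreeInvolutions.size Φ
  fill Λ C : ℕ
  fill = h + (3 + e)
  Λ    = suc ((3 + (h + h)) * p)
  C    = p * suc fill + (p * Λ + (p * (Λ * fill) + (p + p)))

  size-bound : ∀ n → let layers = suc ((3 + (h + h)) * (p * suc n)) in
    p * suc fill + (p * layers + (p * (layers * fill) + (p + p))) ≤ C * suc n
  size-bound n = begin
    p * suc fill + (p * layers + (p * (layers * fill) + (p + p)))
      ≤⟨ ℕᵖ.+-mono-≤ (ℕᵖ.m≤m*n (p * suc fill) N) (ℕᵖ.+-mono-≤ points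
           (ℕᵖ.+-mono-≤ pendants (ℕᵖ.m≤m*n (p + p) N))) ⟩
    p * suc fill * N + (p * Λ * N + (p * (Λ * fill) * N + (p + p) * N))
      ≡⟨ cong (p * suc fill * N +_) (cong (p * Λ * N +_) (sym (ℕᵖ.*-distribʳ-+ N (p * (Λ * fill)) (p + p)))) ⟩
    p * suc fill * N + (p * Λ * N + (p * (Λ * fill) + (p + p)) * N)
      ≡⟨ cong (p * suc fill * N +_) (sym (ℕᵖ.*-distribʳ-+ N (p * Λ) (p * (Λ * fill) + (p + p)))) ⟩
    p * suc fill * N + (p * Λ + (p * (Λ * fill) + (p + p))) * N
      ≡⟨ sym (ℕᵖ.*-distribʳ-+ N (p * suc fill) (p * Λ + (p * (Λ * fill) + (p + p)))) ⟩
    C * N ∎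
    where
    open ℕᵖ.≤-Reasoning
    N layers : ℕ
    N      = suc n
    layers = suc ((3 + (h + h)) * (p * N))
    layers≤ : layers ≤ Λ * N
    layers≤ = ℕᵖ.+-mono-≤ (s≤s (z≤n {n})) (ℕᵖ.≤-reflexive (sym (ℕᵖ.*-assoc (3 + (h + h)) p N)))
    points : p * layers ≤ p * Λ * N
    points = ℕᵖ.≤-trans (ℕᵖ.*-monoʳ-≤ p layers≤) (ℕᵖ.≤-reflexive (sym (ℕᵖ.*-assoc p Λ N)))
    pendants : p * (layers * fill) ≤ p * (Λ * fill) * N
    pendants = begin
      p * (layers * fill)   ≤⟨ ℕᵖ.*-monoʳ-≤ p (ℕᵖ.*-monoˡ-≤ fill layers≤) ⟩
      p * (Λ * N * fill)    ≡⟨ cong (p *_) (trans (ℕᵖ.*-assoc Λ N fill)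
                                 (trans (cong (Λ *_) (ℕᵖ.*-comm N fill)) (sym (ℕᵖ.*-assoc Λ fill N)))) ⟩
      p * (Λ * fill * N)    ≡⟨ sym (ℕᵖ.*-assoc p (Λ * fill) N) ⟩
      p * (Λ * fill) * N    ∎

  Result : ℕ → Set
  Result n = Σ ℕ λ m → Σ (Graph m) λ G̃ → m ≤ C * n × Percolating H G̃ × (Σ ℕ λ t → RunningTime H G̃ t
    × (∀ (G : Graph n) (s : ℕ) → RunningTime H G s → s ≤ t))

  trivial : ∀ n → (∀ (G : Graph n) s → RunningTime H G s → s ≤ 0) → Result n
  trivial n short = 0 , record { adj = λ () ; sym = λ () ; irrefl = λ () } , z≤n , (λ _ _ ()) ,
    0 , ((λ ()) , λ _ ()) , short

  build : ∀ n → (∀ (G : Graph n) s → ¬ RunningTime H G s) ⊎ (Σ ℕ λ M → Σ (Graph n) λ G → RunningTime H G M ×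
            (∀ (G′ : Graph n) s → RunningTime H G′ s → s ≤ M)) → Result n
  build n (inj₁ none)                = trivial n λ G s rt → contradiction rt (none G s)
  build n (inj₂ (zero , _ , _ , max)) = trivial n max
  build (suc n) (inj₂ (suc M , G , rt , max)) with newEdge H G M (proj₂ rt M ℕᵖ.≤-refl)
  ... | u , v , inj₁ old , new = contradiction old new
  ... | u , v , inj₂ last , new = order , G̃ , size-bound n , percolating , proj₁ slow , proj₁ (proj₂ slow) ,
        λ G′ s rt′ → ℕᵖ.≤-trans (max G′ s rt′) (proj₂ (proj₂ slow))
    where
    u≢v : u ≢ v
    u≢v refl = CopyThrough-irrefl H (process H G M) last
    open Construction h e (suc n) Φ u v u≢v using (order)
    open Extremal H insep deg-root e≤deg Φ G rt u≢v last new using (G̃; percolating; slow)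
  build zero (inj₂ (suc M , G , rt , max)) with newEdge H G M (proj₂ rt M ℕᵖ.≤-refl)
  ... | () , _
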